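{- There exists a constant $c>0$ such that, for any fixed integer $k\ge1$, no algorithm for the top-$k$-choice prophet inequality problem with identical distributions selects one of the top $k$ values with probability more than $1-e^{ -c\cdot k}$ (on every instance).
   Context: Top-$k$-choice prophet inequality problem with identical distributions: an instance is a number $n$ and a probability distribution $D$ on the real numbers, both known to the algorithm in advance. Values $x_1,\ldots,x_n$ are drawn independently from $D$ and are presented to the algorithm one at a time. When a value is observed, the algorithm must irrevocably decide whether or not to choose it. The algorithm can make only a single choice, after which the process stops; a value that was observed but not chosen cannot be chosen later. The algorithm succeeds if the value it chooses is one of the $k$ largest among $x_1,\ldots,x_n$ (the top $k$ values). -}

module Defs where

open import Data.Fin.Base using (Fin; toℕ; inject≤) renaming (_<_ to _<ᶠ_)
open import Data.Fin.Properties using (toℕ<n)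
open import Data.Fin.Subset using (Subset) renaming (_∈_ to _∈ˢ_; ∣_∣ to ∣_∣ˢ)
open import Data.Integer.Base as ℤ using (+_; -[1+_])
import Data.Integer.Properties as ℤₚ
open import Data.Nat.Base as ℕ using (ℕ; zero; suc)
import Data.Nat.Properties as ℕₚ
open import Data.Product.Base using (Σ-syntax; ∃-syntax; _×_; _,_; proj₁; proj₂)
open import Data.Rational.Base
open import Data.Rational.Properties
open import Data.Rational.Solver using (module +-*-Solver)
import Data.Rational.Unnormalised.Base as ℚᵘ
import Data.Rational.Unnormalised.Properties as ℚᵘₚ
open import Data.Vec.Functional using (Vector; foldr)
open import Level using (0ℓ) renaming (suc to lsuc)
open import Relation.Binary.PropositionalEquality
  using (_≡_; _≢_; refl; sym; trans; cong; cong₂; subst; subst₂)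
open import Relation.Nullary using (¬_)
open import Relation.Unary using (Pred; U; ∁; ⋃; _∩_; Empty; _≐_)

IsCauchy : (ℕ → ℚ) → Set
IsCauchy s = ∀ ε → 0ℚ < ε → ∃[ N ] ∀ m n → N ℕ.≤ m → N ℕ.≤ n → ∣ s m - s n ∣ < ε

fromℕℚ : ℕ → ℚ
fromℕℚ n = + n / 1

-- qⁱ / i!
expTerm : ℚ → ℕ → ℚ
expTerm q zero    = 1ℚ
expTerm q (suc i) = expTerm q i * (q * (+ 1 / suc i))

expSum : ℚ → ℕ → ℚ
expSum q zero    = 0ℚ
expSum q (suc m) = expSum q m + expTerm q m

module Cauchy where
  open +-*-Solver using (solve; _:+_; _:*_; _:-_; :-_; _:=_; con)

  +-halves : ∀ ε → ½ * ε + ½ * ε ≡ ε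
  +-halves ε = trans (sym (*-distribʳ-+ ε ½ ½)) (*-identityˡ ε)

  0<*  : ∀ {p q} → 0ℚ < p → 0ℚ < q → 0ℚ < p * q
  0<* {p} {q} 0<p 0<q =
    positive⁻¹ _ {{pos*pos⇒pos p {{positive 0<p}} q {{positive 0<q}}}}

  0<½* : ∀ {ε} → 0ℚ < ε → 0ℚ < ½ * ε
  0<½* = 0<* {½} (positive⁻¹ ½)

  0≤∣∣ : ∀ p → 0ℚ ≤ ∣ p ∣
  0≤∣∣ p = nonNegative⁻¹ ∣ p ∣ {{∣-∣-nonNeg p}}

  scale : ∀ {b ε} → 0ℚ < b → 0ℚ < ε → ∃[ δ ] (0ℚ < δ × b * δ ≡ ε)
  scale {b} {ε} 0<b 0<ε = 1/ b * ε , 0<* {1/ b} (positive⁻¹ _ {{1/pos⇒pos b}}) 0<ε ,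
    trans (sym (*-assoc b (1/ b) ε)) (trans (cong (_* ε) (*-inverseʳ b)) (*-identityˡ ε))
    where instance
      _ = positive 0<b
      _ = pos⇒nonZero b {{positive 0<b}}

  *-mono-≤ : ∀ {p q r s} → 0ℚ ≤ r → 0ℚ ≤ q → p ≤ q → r ≤ s → p * r ≤ q * s
  *-mono-≤ {p} {q} {r} {s} 0≤r 0≤q p≤q r≤s = ≤-trans
    (*-monoʳ-≤-nonNeg r {{nonNegative 0≤r}} p≤q)
    (*-monoˡ-≤-nonNeg q {{nonNegative 0≤q}} r≤s)

  triangle : ∀ a b c → ∣ a - c ∣ ≤ ∣ a - b ∣ + ∣ b - c ∣
  triangle a b c = subst (λ z → ∣ z ∣ ≤ ∣ a - b ∣ + ∣ b - c ∣)
    (solve 3 (λ a b c → (a :- b) :+ (b :- c) := a :- c) refl a b c)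
    (∣p+q∣≤∣p∣+∣q∣ (a - b) (b - c))

  dist-+ : ∀ a b c d → ∣ (a + b) - (c + d) ∣ ≤ ∣ a - c ∣ + ∣ b - d ∣
  dist-+ a b c d = subst (λ z → ∣ z ∣ ≤ ∣ a - c ∣ + ∣ b - d ∣)
    (solve 4 (λ a b c d → (a :- c) :+ (b :- d) := (a :+ b) :- (c :+ d)) refl a b c d)
    (∣p+q∣≤∣p∣+∣q∣ (a - c) (b - d))

  dist-* : ∀ a b c d → ∣ a * b - c * d ∣ ≤ ∣ a ∣ * ∣ b - d ∣ + ∣ d ∣ * ∣ a - c ∣
  dist-* a b c d = subst₂ _≤_
    (cong ∣_∣ (solve 4 (λ a b c d → a :* (b :- d) :+ d :* (a :- c) := a :* b :- c :* d) refl a b c d))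
    (cong₂ _+_ (∣p*q∣≡∣p∣*∣q∣ a (b - d)) (∣p*q∣≡∣p∣*∣q∣ d (a - c)))
    (∣p+q∣≤∣p∣+∣q∣ (a * (b - d)) (d * (a - c)))

  dist-neg : ∀ a b → ∣ (- a) - (- b) ∣ ≡ ∣ a - b ∣
  dist-neg a b = trans (cong ∣_∣ (solve 2 (λ a b → :- a :- :- b := :- (a :- b)) refl a b)) (∣-p∣≡∣p∣ (a - b))

  bounded : ∀ s → IsCauchy s → ∃[ b ] ∃[ N ] (0ℚ < b × ∀ n → N ℕ.≤ n → ∣ s n ∣ ≤ b)
  bounded s cs = let N , h = cs 1ℚ (positive⁻¹ 1ℚ) in
    1ℚ + ∣ s N ∣ , N , +-mono-<-≤ (positive⁻¹ 1ℚ) (0≤∣∣ (s N)) , λ n N≤n → begin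
      ∣ s n ∣                  ≡⟨ cong ∣_∣ (solve 2 (λ a b → a := (a :- b) :+ b) refl (s n) (s N)) ⟩
      ∣ (s n - s N) + s N ∣     ≤⟨ ∣p+q∣≤∣p∣+∣q∣ (s n - s N) (s N) ⟩
      ∣ s n - s N ∣ + ∣ s N ∣   ≤⟨ +-monoˡ-≤ ∣ s N ∣ (<⇒≤ (h n N N≤n ℕₚ.≤-refl)) ⟩
      1ℚ + ∣ s N ∣             ∎
    where open ≤-Reasoning

  const-cauchy : ∀ q → IsCauchy (λ _ → q)
  const-cauchy q ε 0<ε = 0 , λ _ _ _ _ → subst (λ z → ∣ z ∣ < ε) (sym (+-inverseʳ q)) 0<ε

  +-cauchy : ∀ s t → IsCauchy s → IsCauchy t → IsCauchy (λ n → s n + t n)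
  +-cauchy s t cs ct ε 0<ε =
    let M , f = cs (½ * ε) (0<½* 0<ε)
        N , g = ct (½ * ε) (0<½* 0<ε)
    in M ℕ.⊔ N , λ m n p q → ≤-<-trans (dist-+ (s m) (t m) (s n) (t n))
      (subst (∣ s m - s n ∣ + ∣ t m - t n ∣ <_) (+-halves ε)
        (+-mono-< (f m n (ℕₚ.m⊔n≤o⇒m≤o M N p) (ℕₚ.m⊔n≤o⇒m≤o M N q))
                  (g m n (ℕₚ.m⊔n≤o⇒n≤o M N p) (ℕₚ.m⊔n≤o⇒n≤o M N q))))

  neg-cauchy : ∀ s → IsCauchy s → IsCauchy (λ n → - s n)
  neg-cauchy s cs ε 0<ε = let N , f = cs ε 0<ε in
    N , λ m n p q → subst (_< ε) (sym (dist-neg (s m) (s n))) (f m n p q)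

  *-cauchy : ∀ s t → IsCauchy s → IsCauchy t → IsCauchy (λ n → s n * t n)
  *-cauchy s t cs ct ε 0<ε =
    let a , M₁ , 0<a , s≤a = bounded s cs
        b , N₁ , 0<b , t≤b = bounded t ct
        δ , 0<δ , aδ = scale 0<a (0<½* 0<ε)
        η , 0<η , bη = scale 0<b (0<½* 0<ε)
        N₂ , g = ct δ 0<δ
        M₂ , f = cs η 0<η
        open ≤-Reasoning
    in (M₁ ℕ.⊔ N₁) ℕ.⊔ (M₂ ℕ.⊔ N₂) , λ m n p q →
      let pm = ℕₚ.m⊔n≤o⇒m≤o (M₁ ℕ.⊔ N₁) (M₂ ℕ.⊔ N₂) p
          pn = ℕₚ.m⊔n≤o⇒m≤o (M₁ ℕ.⊔ N₁) (M₂ ℕ.⊔ N₂) q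
          qm = ℕₚ.m⊔n≤o⇒n≤o (M₁ ℕ.⊔ N₁) (M₂ ℕ.⊔ N₂) p
          qn = ℕₚ.m⊔n≤o⇒n≤o (M₁ ℕ.⊔ N₁) (M₂ ℕ.⊔ N₂) q
          gmn = g m n (ℕₚ.m⊔n≤o⇒n≤o M₂ N₂ qm) (ℕₚ.m⊔n≤o⇒n≤o M₂ N₂ qn)
          fmn = f m n (ℕₚ.m⊔n≤o⇒m≤o M₂ N₂ qm) (ℕₚ.m⊔n≤o⇒m≤o M₂ N₂ qn)
      in begin-strict
        ∣ s m * t m - s n * t n ∣
          ≤⟨ dist-* (s m) (t m) (s n) (t n) ⟩
        ∣ s m ∣ * ∣ t m - t n ∣ + ∣ t n ∣ * ∣ s m - s n ∣
          ≤⟨ +-mono-≤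
              (*-mono-≤ (0≤∣∣ (t m - t n)) (<⇒≤ 0<a) (s≤a m (ℕₚ.m⊔n≤o⇒m≤o M₁ N₁ pm)) ≤-refl)
              (*-mono-≤ (0≤∣∣ (s m - s n)) (<⇒≤ 0<b) (t≤b n (ℕₚ.m⊔n≤o⇒n≤o M₁ N₁ pn)) ≤-refl) ⟩
        a * ∣ t m - t n ∣ + b * ∣ s m - s n ∣
          <⟨ +-mono-< (*-monoʳ-<-pos a {{positive 0<a}} gmn)
                      (*-monoʳ-<-pos b {{positive 0<b}} fmn) ⟩
        a * δ + b * η
          ≡⟨ trans (cong₂ _+_ aδ bη) (+-halves ε) ⟩
        ε ∎

  expTerm-cauchy : ∀ s → IsCauchy s → ∀ i → IsCauchy (λ n → expTerm (s n) i)
  expTerm-cauchy s cs zero    = const-cauchy 1ℚ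
  expTerm-cauchy s cs (suc i) =
    *-cauchy (λ n → expTerm (s n) i) (λ n → s n * (+ 1 / suc i)) (expTerm-cauchy s cs i)
      (*-cauchy s (λ _ → + 1 / suc i) cs (const-cauchy (+ 1 / suc i)))

  expSum-cauchy : ∀ s → IsCauchy s → ∀ m → IsCauchy (λ n → expSum (s n) m)
  expSum-cauchy s cs zero    = const-cauchy 0ℚ
  expSum-cauchy s cs (suc m) =
    +-cauchy (λ n → expSum (s n) m) (λ n → expTerm (s n) m)
      (expSum-cauchy s cs m) (expTerm-cauchy s cs m)

  toℚᵘ-/ : ∀ n d → toℚᵘ (n / suc d) ℚᵘ.≃ ℚᵘ.mkℚᵘ n d
  toℚᵘ-/ n d = toℚᵘ-fromℚᵘ (ℚᵘ.mkℚᵘ n d)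

  recip : ∀ i → fromℕℚ (suc i) * (+ 1 / suc i) ≡ 1ℚ
  recip i = toℚᵘ-injective (begin
    toℚᵘ (fromℕℚ (suc i) * (+ 1 / suc i))           ≈⟨ toℚᵘ-homo-* (fromℕℚ (suc i)) (+ 1 / suc i) ⟩
    toℚᵘ (fromℕℚ (suc i)) ℚᵘ.* toℚᵘ (+ 1 / suc i)    ≈⟨ ℚᵘₚ.*-cong (toℚᵘ-/ (+ suc i) 0) (toℚᵘ-/ (+ 1) i) ⟩
    ℚᵘ.mkℚᵘ (+ suc i) 0 ℚᵘ.* ℚᵘ.mkℚᵘ (+ 1) i         ≈⟨ ℚᵘ.*≡* (cong +_ eq) ⟩
    ℚᵘ.1ℚᵘ                                          ∎)
    where
    open ℚᵘₚ.≃-Reasoning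
    eq : suc (i ℕ.* 1 ℕ.* 1) ≡ suc (i ℕ.+ 0 ℕ.+ 0)
    eq = cong suc (trans (trans (ℕₚ.*-identityʳ _) (ℕₚ.*-identityʳ i))
      (sym (trans (ℕₚ.+-identityʳ _) (ℕₚ.+-identityʳ i))))

  fromℕℚ-mono : ∀ {m n} → m ℕ.≤ n → fromℕℚ m ≤ fromℕℚ n
  fromℕℚ-mono {m} {n} m≤n = toℚᵘ-cancel-≤ (begin
    toℚᵘ (fromℕℚ m)       ≃⟨ toℚᵘ-/ (+ m) 0 ⟩
    ℚᵘ.mkℚᵘ (+ m) 0      ≤⟨ ℚᵘ.*≤* (ℤₚ.*-monoʳ-≤-nonNeg (+ 1) (ℤ.+≤+ m≤n)) ⟩
    ℚᵘ.mkℚᵘ (+ n) 0      ≃⟨ ℚᵘₚ.≃-sym (toℚᵘ-/ (+ n) 0) ⟩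
    toℚᵘ (fromℕℚ n)      ∎)
    where open ℚᵘₚ.≤-Reasoning

  fromℕℚ-suc : ∀ n → fromℕℚ (suc n) ≡ 1ℚ + fromℕℚ n
  fromℕℚ-suc n = toℚᵘ-injective (begin
    toℚᵘ (fromℕℚ (suc n))             ≈⟨ toℚᵘ-/ (+ suc n) 0 ⟩
    ℚᵘ.mkℚᵘ (+ suc n) 0              ≈⟨ ℚᵘ.*≡* (cong (ℤ._* + 1) (cong (ℤ._+_ (+ 1)) (sym (ℤₚ.*-identityʳ (+ n))))) ⟩
    ℚᵘ.1ℚᵘ ℚᵘ.+ ℚᵘ.mkℚᵘ (+ n) 0       ≈⟨ ℚᵘₚ.+-congʳ ℚᵘ.1ℚᵘ (ℚᵘₚ.≃-sym (toℚᵘ-/ (+ n) 0)) ⟩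
    ℚᵘ.1ℚᵘ ℚᵘ.+ toℚᵘ (fromℕℚ n)       ≈⟨ ℚᵘₚ.≃-sym (toℚᵘ-homo-+ 1ℚ (fromℕℚ n)) ⟩
    toℚᵘ (1ℚ + fromℕℚ n)             ∎)
    where open ℚᵘₚ.≃-Reasoning

  archimedean : ∀ q → ∃[ n ] q ≤ fromℕℚ n
  archimedean q@(mkℚ (+ n) d _) = n , toℚᵘ-cancel-≤ (begin
    toℚᵘ q              ≤⟨ ℚᵘ.*≤* (ℤₚ.*-monoˡ-≤-nonNeg (+ n) (ℤ.+≤+ (ℕ.s≤s (ℕ.z≤n {d})))) ⟩
    ℚᵘ.mkℚᵘ (+ n) 0     ≃⟨ ℚᵘₚ.≃-sym (toℚᵘ-/ (+ n) 0) ⟩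
    toℚᵘ (fromℕℚ n)     ∎)
    where open ℚᵘₚ.≤-Reasoning
  archimedean (mkℚ -[1+ n ] d _) = 0 , *≤* ℤ.-≤+

  0≤1/ : ∀ i → 0ℚ ≤ + 1 / suc i
  0≤1/ i = nonNegative⁻¹ _ {{normalize-nonNeg 1 (suc i)}}

  abs-suc : ∀ q i → ∣ expTerm q (suc i) ∣ ≡ ∣ expTerm q i ∣ * (∣ q ∣ * (+ 1 / suc i))
  abs-suc q i = trans (∣p*q∣≡∣p∣*∣q∣ (expTerm q i) _)
    (cong (∣ expTerm q i ∣ *_) (trans (∣p*q∣≡∣p∣*∣q∣ q _)
      (cong (∣ q ∣ *_) (0≤p⇒∣p∣≡p (0≤1/ i)))))

  0≤p*q : ∀ {p q} → 0ℚ ≤ p → 0ℚ ≤ q → 0ℚ ≤ p * q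
  0≤p*q {p} {q} 0≤p 0≤q = subst (_≤ p * q) (*-zeroʳ p) (*-monoˡ-≤-nonNeg p {{nonNegative 0≤p}} 0≤q)

  module Tail (b : ℚ) (0<b : 0ℚ < b) where
    0≤b : 0ℚ ≤ b
    0≤b = <⇒≤ 0<b

    0≤term : ∀ i → 0ℚ ≤ expTerm b i
    0≤term zero    = <⇒≤ (positive⁻¹ 1ℚ)
    0≤term (suc i) = 0≤p*q (0≤term i) (0≤p*q 0≤b (0≤1/ i))

    i₀ : ℕ
    i₀ = proj₁ (archimedean (b + b))

    ratio≤½ : ∀ i → i₀ ℕ.≤ i → b * (+ 1 / suc i) ≤ ½
    ratio≤½ i i₀≤i = begin
      b * r                            ≡⟨ solve 2 (λ b r → b :* r := con ½ :* ((b :+ b) :* r)) refl b r ⟩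
      ½ * ((b + b) * r)                ≤⟨ *-monoˡ-≤-nonNeg ½ (*-monoʳ-≤-nonNeg r {{nonNegative (0≤1/ i)}}
                                            (≤-trans (proj₂ (archimedean (b + b))) (fromℕℚ-mono (ℕₚ.m≤n⇒m≤1+n i₀≤i)))) ⟩
      ½ * (fromℕℚ (suc i) * r)          ≡⟨ cong (½ *_) (recip i) ⟩
      ½ * 1ℚ                           ≡⟨ *-identityʳ ½ ⟩
      ½                                ∎
      where
      open ≤-Reasoning
      r = + 1 / suc i

    term≤ : ∀ q → ∣ q ∣ ≤ b → ∀ i → ∣ expTerm q i ∣ ≤ expTerm b i
    term≤ q q≤b zero    = ≤-refl
    term≤ q q≤b (suc i) = ≤-trans (≤-reflexive (abs-suc q i))
      (*-mono-≤ (0≤p*q (0≤∣∣ q) (0≤1/ i)) (0≤term i) (term≤ q q≤b i)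
        (*-monoʳ-≤-nonNeg _ {{nonNegative (0≤1/ i)}} q≤b))

    halving : ∀ q → ∣ q ∣ ≤ b → ∀ i → i₀ ℕ.≤ i → ∣ expTerm q (suc i) ∣ ≤ ∣ expTerm q i ∣ * ½
    halving q q≤b i i₀≤i = ≤-trans (≤-reflexive (abs-suc q i))
      (*-monoˡ-≤-nonNeg ∣ expTerm q i ∣ {{nonNegative (0≤∣∣ (expTerm q i))}}
        (≤-trans (*-monoʳ-≤-nonNeg _ {{nonNegative (0≤1/ i)}} q≤b) (ratio≤½ i i₀≤i)))

    tail : ∀ q → ∣ q ∣ ≤ b → ∀ N → i₀ ℕ.≤ N → ∀ d →
           ∣ expSum q (d ℕ.+ N) - expSum q N ∣ + (∣ expTerm q (d ℕ.+ N) ∣ + ∣ expTerm q (d ℕ.+ N) ∣)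
           ≤ ∣ expTerm q N ∣ + ∣ expTerm q N ∣
    tail q q≤b N i₀≤N zero = ≤-reflexive (trans
      (cong (λ z → ∣ z ∣ + (∣ expTerm q N ∣ + ∣ expTerm q N ∣)) (+-inverseʳ (expSum q N)))
      (+-identityˡ _))
    tail q q≤b N i₀≤N (suc d) = begin
      ∣ (S + t) - S₀ ∣ + (∣ t′ ∣ + ∣ t′ ∣)
        ≤⟨ +-mono-≤
             (subst (λ z → ∣ z ∣ ≤ ∣ S - S₀ ∣ + ∣ t ∣)
               (solve 3 (λ a b c → (a :- c) :+ b := (a :+ b) :- c) refl S t S₀)
               (∣p+q∣≤∣p∣+∣q∣ (S - S₀) t))
             (+-mono-≤ h h) ⟩
      (∣ S - S₀ ∣ + ∣ t ∣) + (∣ t ∣ * ½ + ∣ t ∣ * ½)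
        ≡⟨ solve 2 (λ a b → (a :+ b) :+ (b :* con ½ :+ b :* con ½) := a :+ (b :+ b)) refl ∣ S - S₀ ∣ ∣ t ∣ ⟩
      ∣ S - S₀ ∣ + (∣ t ∣ + ∣ t ∣)
        ≤⟨ tail q q≤b N i₀≤N d ⟩
      ∣ expTerm q N ∣ + ∣ expTerm q N ∣ ∎
      where
      open ≤-Reasoning
      S = expSum q (d ℕ.+ N)
      S₀ = expSum q N
      t = expTerm q (d ℕ.+ N)
      t′ = expTerm q (suc d ℕ.+ N)
      h = halving q q≤b (d ℕ.+ N) (ℕₚ.≤-trans i₀≤N (ℕₚ.m≤n+m N d))

    decay : ∀ j → fromℕℚ (suc j) * expTerm b (j ℕ.+ i₀) ≤ expTerm b i₀
    decay zero    = ≤-reflexive (*-identityˡ _)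
    decay (suc j) = begin
      fromℕℚ (suc (suc j)) * T′        ≤⟨ *-monoˡ-≤-nonNeg (fromℕℚ (suc (suc j))) {{nonNegative (0≤fromℕ (suc (suc j)))}} T′≤ ⟩
      fromℕℚ (suc (suc j)) * (T * ½)   ≡⟨ cong (_* (T * ½)) (fromℕℚ-suc (suc j)) ⟩
      (1ℚ + x) * (T * ½)              ≤⟨ *-monoʳ-≤-nonNeg (T * ½) {{nonNegative (0≤p*q (0≤term (j ℕ.+ i₀)) (nonNegative⁻¹ ½))}}
                                          (+-monoˡ-≤ x (fromℕℚ-mono (ℕ.s≤s (ℕ.z≤n {j})))) ⟩
      (x + x) * (T * ½)               ≡⟨ solve 2 (λ x t → (x :+ x) :* (t :* con ½) := x :* t) refl x T ⟩
      x * T                           ≤⟨ decay j ⟩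
      expTerm b i₀                    ∎
      where
      open ≤-Reasoning
      0≤fromℕ : ∀ n → 0ℚ ≤ fromℕℚ n
      0≤fromℕ n = fromℕℚ-mono (ℕ.z≤n {n})
      x = fromℕℚ (suc j)
      T = expTerm b (j ℕ.+ i₀)
      T′ = expTerm b (suc j ℕ.+ i₀)
      T′≤ : T′ ≤ T * ½
      T′≤ = *-monoˡ-≤-nonNeg T {{nonNegative (0≤term (j ℕ.+ i₀))}}
              (ratio≤½ (j ℕ.+ i₀) (ℕₚ.m≤n+m i₀ j))

    tail-small : ∀ ε → 0ℚ < ε → ∃[ N ] ∀ q → ∣ q ∣ ≤ b → ∀ m → N ℕ.≤ m →
                 ∣ expSum q m - expSum q N ∣ < ε
    tail-small ε 0<ε =
      let T₀ = expTerm b i₀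
          δ , 0<δ , εδ = scale {ε} {1ℚ + (T₀ + T₀)} 0<ε
            (+-mono-<-≤ (positive⁻¹ 1ℚ) (+-mono-≤ (0≤term i₀) (0≤term i₀)))
          j , δ≤j = archimedean δ
          N = j ℕ.+ i₀
          T = expTerm b N
          open ≤-Reasoning
          2T<ε : T + T < ε
          2T<ε = *-cancelʳ-<-nonNeg δ {{nonNegative (<⇒≤ 0<δ)}} (begin-strict
            (T + T) * δ     ≤⟨ *-monoˡ-≤-nonNeg (T + T) {{nonNegative (+-mono-≤ (0≤term N) (0≤term N))}}
                                 (≤-trans δ≤j (fromℕℚ-mono (ℕₚ.n≤1+n j))) ⟩
            (T + T) * fromℕℚ (suc j)
                            ≡⟨ solve 2 (λ t x → (t :+ t) :* x := x :* t :+ x :* t) refl T (fromℕℚ (suc j)) ⟩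
            fromℕℚ (suc j) * T + fromℕℚ (suc j) * T
                            ≤⟨ +-mono-≤ (decay j) (decay j) ⟩
            T₀ + T₀         ≡⟨ sym (+-identityˡ _) ⟩
            0ℚ + (T₀ + T₀)  <⟨ +-monoˡ-< (T₀ + T₀) (positive⁻¹ 1ℚ) ⟩
            1ℚ + (T₀ + T₀)  ≡⟨ sym εδ ⟩
            ε * δ           ∎)
      in N , λ q q≤b m N≤m →
        let t = expTerm q m
            d = m ℕ.∸ N
        in subst (λ k → ∣ expSum q k - expSum q N ∣ < ε) (ℕₚ.m∸n+n≡m N≤m) (begin-strict
          ∣ expSum q (d ℕ.+ N) - expSum q N ∣
            ≡⟨ sym (+-identityʳ _) ⟩
          ∣ expSum q (d ℕ.+ N) - expSum q N ∣ + 0ℚ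
            ≤⟨ +-monoʳ-≤ ∣ expSum q (d ℕ.+ N) - expSum q N ∣
                 (+-mono-≤ (0≤∣∣ (expTerm q (d ℕ.+ N))) (0≤∣∣ (expTerm q (d ℕ.+ N)))) ⟩
          ∣ expSum q (d ℕ.+ N) - expSum q N ∣ + (∣ expTerm q (d ℕ.+ N) ∣ + ∣ expTerm q (d ℕ.+ N) ∣)
            ≤⟨ tail q q≤b N (ℕₚ.m≤n+m i₀ j) d ⟩
          ∣ expTerm q N ∣ + ∣ expTerm q N ∣
            ≤⟨ +-mono-≤ (term≤ q q≤b N) (term≤ q q≤b N) ⟩
          T + T <⟨ 2T<ε ⟩
          ε ∎)

  exp-cauchy : ∀ s → IsCauchy s → IsCauchy (λ n → expSum (s n) n)
  exp-cauchy s cs ε 0<ε =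
    let b , M , 0<b , s≤b = bounded s cs
        L , small = Tail.tail-small b 0<b (½ * (½ * ε)) (0<½* (0<½* 0<ε))
        K , close = expSum-cauchy s cs L (½ * ε) (0<½* 0<ε)
        open ≤-Reasoning
    in (M ℕ.⊔ L) ℕ.⊔ K , λ m n p q →
      let pm = ℕₚ.m⊔n≤o⇒m≤o (M ℕ.⊔ L) K p
          qn = ℕₚ.m⊔n≤o⇒m≤o (M ℕ.⊔ L) K q
          a = expSum (s m) m
          a′ = expSum (s m) L
          c = expSum (s n) n
          c′ = expSum (s n) L
          am = small (s m) (s≤b m (ℕₚ.m⊔n≤o⇒m≤o M L pm)) m (ℕₚ.m⊔n≤o⇒n≤o M L pm)
          cn = small (s n) (s≤b n (ℕₚ.m⊔n≤o⇒m≤o M L qn)) n (ℕₚ.m⊔n≤o⇒n≤o M L qn)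
          ac = close m n (ℕₚ.m⊔n≤o⇒n≤o (M ℕ.⊔ L) K p) (ℕₚ.m⊔n≤o⇒n≤o (M ℕ.⊔ L) K q)
      in begin-strict
        ∣ a - c ∣
          ≤⟨ triangle a a′ c ⟩
        ∣ a - a′ ∣ + ∣ a′ - c ∣
          ≤⟨ +-monoʳ-≤ ∣ a - a′ ∣ (triangle a′ c′ c) ⟩
        ∣ a - a′ ∣ + (∣ a′ - c′ ∣ + ∣ c′ - c ∣)
          ≡⟨ cong (λ z → ∣ a - a′ ∣ + (∣ a′ - c′ ∣ + z))
               (trans (sym (∣-p∣≡∣p∣ (c′ - c))) (cong ∣_∣ (solve 2 (λ x y → :- (x :- y) := y :- x) refl c′ c))) ⟩
        ∣ a - a′ ∣ + (∣ a′ - c′ ∣ + ∣ c - c′ ∣)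
          <⟨ +-mono-< am (+-mono-< ac cn) ⟩
        ½ * (½ * ε) + (½ * ε + ½ * (½ * ε))
          ≡⟨ solve 1 (λ e → con ½ :* (con ½ :* e) :+ (con ½ :* e :+ con ½ :* (con ½ :* e)) := e) refl ε ⟩
        ε ∎

record ℝ : Set where
  constructor mkℝ
  field
    seq    : ℕ → ℚ
    cauchy : IsCauchy seq

open ℝ public

infix  4 _≈ℝ_ _<ℝ_ _≤ℝ_
infixl 6 _+ℝ_ _-ℝ_
infixl 7 _*ℝ_
infix  8 -ℝ_

_≈ℝ_ : ℝ → ℝ → Set
x ≈ℝ y = ∀ ε → 0ℚ < ε → ∃[ N ] ∀ n → N ℕ.≤ n → ∣ seq x n - seq y n ∣ < ε

_<ℝ_ : ℝ → ℝ → Set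
x <ℝ y = ∃[ ε ] (0ℚ < ε × ∃[ N ] ∀ n → N ℕ.≤ n → seq x n + ε ≤ seq y n)

_≤ℝ_ : ℝ → ℝ → Set
x ≤ℝ y = ∀ ε → 0ℚ < ε → ∃[ N ] ∀ n → N ℕ.≤ n → seq x n ≤ seq y n + ε

fromℚ : ℚ → ℝ
fromℚ q = mkℝ (λ _ → q) (Cauchy.const-cauchy q)

fromℕ : ℕ → ℝ
fromℕ n = fromℚ (fromℕℚ n)

0ℝ 1ℝ : ℝ
0ℝ = fromℚ 0ℚ
1ℝ = fromℚ 1ℚ

_+ℝ_ : ℝ → ℝ → ℝ
mkℝ s cs +ℝ mkℝ t ct = mkℝ (λ n → s n + t n) (Cauchy.+-cauchy s t cs ct)

-ℝ_ : ℝ → ℝ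
-ℝ mkℝ s cs = mkℝ (λ n → - s n) (Cauchy.neg-cauchy s cs)

_-ℝ_ : ℝ → ℝ → ℝ
x -ℝ y = x +ℝ (-ℝ y)

_*ℝ_ : ℝ → ℝ → ℝ
mkℝ s cs *ℝ mkℝ t ct = mkℝ (λ n → s n * t n) (Cauchy.*-cauchy s t cs ct)

-- The diagonal of the partial sums: if x is represented by the sequence s,
-- the n-th approximation of exp x is Σ_{i<n} (s n)^i / i!.
exp : ℝ → ℝ
exp (mkℝ s cs) = mkℝ (λ n → expSum (s n) n) (Cauchy.exp-cauchy s cs)

sumℝ prodℝ : ∀ {n} → Vector ℝ n → ℝ
sumℝ  = foldr _+ℝ_ 0ℝ
prodℝ = foldr _*ℝ_ 1ℝ

infix 4 _⟶_
_⟶_ : (ℕ → ℝ) → ℝ → Set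
s ⟶ x = ∀ ε → 0ℝ <ℝ ε → ∃[ N ] ∀ n → N ℕ.≤ n → (x -ℝ ε <ℝ s n) × (s n <ℝ x +ℝ ε)

Event : Set → Set₁
Event X = Pred X 0ℓ

record MeasurableSpace : Set₂ where
  field
    Carrier    : Set
    Measurable : Pred (Event Carrier) (lsuc 0ℓ)
    resp       : ∀ {A B} → A ≐ B → Measurable A → Measurable B
    whole      : Measurable U
    complement : ∀ {A} → Measurable A → Measurable (∁ A)
    union      : ∀ {A : ℕ → Event Carrier} → (∀ i → Measurable (A i)) →
                 Measurable (⋃ ℕ A)

open MeasurableSpace public using (Carrier; Measurable)

data Generated {X : Set} (G : Pred (Event X) (lsuc 0ℓ)) : Pred (Event X) (lsuc 0ℓ) where
  base       : ∀ {A} → G A → Generated G A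
  resp       : ∀ {A B} → A ≐ B → Generated G A → Generated G B
  whole      : Generated G U
  complement : ∀ {A} → Generated G A → Generated G (∁ A)
  union      : ∀ {A : ℕ → Event X} → (∀ i → Generated G (A i)) → Generated G (⋃ ℕ A)

generate : {X : Set} → Pred (Event X) (lsuc 0ℓ) → MeasurableSpace
generate {X} G = record
  { Carrier    = X
  ; Measurable = Generated G
  ; resp       = resp
  ; whole      = whole
  ; complement = complement
  ; union      = union
  }

data IsRay : Pred (Event ℝ) (lsuc 0ℓ) where
  ray : ∀ a → IsRay (_≤ℝ a)

Borel : MeasurableSpace
Borel = generate IsRay

Rectangle : ∀ {X n} → Event X → (Fin n → Event ℝ) → Event (X × Vector ℝ n)
Rectangle C B (s , x) = C s × (∀ i → B i (x i))

data IsRectangle (M : MeasurableSpace) (n : ℕ) :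
                 Pred (Event (Carrier M × Vector ℝ n)) (lsuc 0ℓ) where
  rectangle : ∀ {C B} → Measurable M C → (∀ i → Measurable Borel (B i)) →
              IsRectangle M n (Rectangle C B)

infixl 6 _⊗ℝ^_
_⊗ℝ^_ : MeasurableSpace → ℕ → MeasurableSpace
M ⊗ℝ^ n = generate (IsRectangle M n)

-- prob is total so that it does not depend on a proof of measurability; its
-- values on non-measurable events are meaningless.
record ProbabilityMeasure (M : MeasurableSpace) : Set₁ where
  field
    prob       : Event (Carrier M) → ℝ
    prob-cong  : ∀ {A B} → Measurable M A → A ≐ B → prob A ≈ℝ prob B
    prob-≥0    : ∀ {A} → Measurable M A → 0ℝ ≤ℝ prob A
    prob-whole : prob U ≈ℝ 1ℝ
    σ-additive : ∀ {A : ℕ → Event (Carrier M)} → (∀ i → Measurable M (A i)) →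
                 (∀ i j → i ≢ j → Empty (A i ∩ A j)) →
                 (λ m → sumℝ {m} (λ i → prob (A (toℕ i)))) ⟶ prob (⋃ ℕ A)

open ProbabilityMeasure public using (prob)

-- μ ⊗ Dⁿ is determined by its values on measurable rectangles: it is the joint
-- law of s , x₁ , … , xₙ, all independent, with s distributed according to μ
-- and each xᵢ according to D.
record ProductMeasure {M : MeasurableSpace} (μ : ProbabilityMeasure M)
                      (D : ProbabilityMeasure Borel) (n : ℕ) : Set₁ where
  field
    measure      : ProbabilityMeasure (M ⊗ℝ^ n)
    on-rectangle : ∀ {C B} → Measurable M C → (∀ i → Measurable Borel (B i)) →
                   prob measure (Rectangle C B) ≈ℝ
                   prob μ C *ℝ prodℝ {n} (λ i → prob D (B i))

open ProductMeasure public using (measure)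

-- For size 0 nothing can be selected, which would make the impossibility claim
-- trivial.
record Instance : Set₁ where
  field
    size   : ℕ
    size≥1 : 1 ℕ.≤ size
    dist   : ProbabilityMeasure Borel

open Instance public using (size; dist)

-- The values observed up to and including the one at position i.
observed : ∀ {n} → Vector ℝ n → (i : Fin n) → Vector ℝ (suc (toℕ i))
observed x i j = x (inject≤ j (toℕ<n i))

-- Strategies may be randomised: the seed is drawn once, independently of the
-- values.  A strategy is deterministic when its seed space is a point.  The
-- event accept i is the set of seeds and observed values for which the value at
-- position i is chosen, if no earlier one has been.
record Strategy (n : ℕ) : Set₂ where
  field
    Seed              : MeasurableSpace
    seedLaw           : ProbabilityMeasure Seed
    accept            : (i : Fin n) → Event (Carrier Seed × Vector ℝ (suc (toℕ i)))
    accept-measurable : ∀ i → Measurable (Seed ⊗ℝ^ suc (toℕ i)) (accept i)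

-- The instance, including the distribution, is known in advance.
Algorithm : Set₂
Algorithm = (I : Instance) → Strategy (size I)

-- x i is one of the k largest values when fewer than k values are strictly
-- larger, so a value tied with the k-th largest counts.
IsTop : ∀ {n} → ℕ → Vector ℝ n → Fin n → Set
IsTop {n} k x i = (T : Subset n) → (∀ {j} → j ∈ˢ T → x i <ℝ x j) → ∣ T ∣ˢ ℕ.< k

module _ {n : ℕ} (σ : Strategy n) where
  open Strategy σ

  Chooses : Fin n → Event (Carrier Seed × Vector ℝ n)
  Chooses i (s , x) = accept i (s , observed x i) ×
                      (∀ j → j <ᶠ i → ¬ accept j (s , observed x j))

  Success : ℕ → Event (Carrier Seed × Vector ℝ n)
  Success k (s , x) = ∃[ i ] (Chooses i (s , x) × IsTop k x i)

-- The product measure is unique, so quantifying over P only names it.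
SelectsTopWithProbabilityMoreThan : ℝ → ℕ → Algorithm → Instance → Set₁
SelectsTopWithProbabilityMoreThan p k A I =
  (P : ProductMeasure (Strategy.seedLaw (A I)) (dist I) (size I)) →
  p <ℝ prob (measure P) (Success (A I) k)

module Submission where

-- Take n = 2k values, uniform on {0, 1, 2}, and c = 9.  On 1ᵏ0ᵏ only the first k
-- values are among the top k, on 1ᵏ2ᵏ only the last k are.  As the algorithm
-- cannot tell the two apart before position k, no seed succeeds on both, so the
-- success probabilities on these two inputs add up to at most 1.  Each input has
-- probability 9⁻ᵏ, hence the algorithm fails with probability at least 9⁻ᵏ.
--
-- For e^(-9k) ≤ 9⁻ᵏ: the single term (9k)ᵏ/k! of e^(9k) is at least 9ᵏ, and
-- e^(-x) e^x = 1 by the Cauchy product, whose error on partial sums is dominated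
-- by a tail of the series for e^(2x).

open import Axiom.ExcludedMiddle using (ExcludedMiddle)
open import Data.Empty using (⊥; ⊥-elim)
open import Data.Fin.Base using (Fin; zero; suc; toℕ; inject≤; fromℕ<; reduce≥) renaming (_<_ to _<ᶠ_)
open import Data.Fin.Patterns using (0F; 1F; 2F)
open import Data.Fin.Properties using (toℕ<n; toℕ-inject≤)
open import Data.Fin.Subset using (Subset; inside; outside) renaming (_∈_ to _∈ˢ_; ∣_∣ to ∣_∣ˢ)
open import Data.Fin.Subset.Properties using (∣⊤∣≡n)
open import Data.Integer.Base using (+_)
open import Data.Nat.Base as ℕ using (ℕ; zero; suc)
import Data.Nat.Properties as ℕₚ
open import Data.Product.Base using (Σ-syntax; ∃-syntax; _×_; _,_; proj₁)
open import Data.Rational.Base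
open import Data.Rational.Properties
open import Data.Rational.Solver using (module +-*-Solver)
open import Data.Sum.Base using (_⊎_; inj₁; inj₂)
open import Data.Unit.Base using (tt)
open import Data.Vec.Base using (Vec; []; _∷_; _++_; lookup; replicate)
open import Data.Vec.Functional using (Vector)
open import Data.Vec.Properties using (lookup-++-<; lookup-++-≥; lookup-replicate; []=⇒lookup)
open import Function.Base using (_∘_)
open import Level using (0ℓ)
open import Relation.Binary.Definitions using (tri<; tri≈; tri>)
open import Relation.Binary.PropositionalEquality
  using (_≡_; _≢_; refl; sym; trans; cong; cong₂; subst; subst₂; module ≡-Reasoning)
open import Relation.Nullary using (¬_; Dec; yes; no; contradiction)
open import Relation.Nullary.Decidable using (toWitness)
open import Relation.Unary using (U; ⋃; _∩_; Empty)
open import Defs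
open Cauchy using (0≤p*q; 0≤1/; recip; fromℕℚ-suc; fromℕℚ-mono; abs-suc; 0<½*; +-halves)
open +-*-Solver using (solve; _:+_; _:*_; _:-_; :-_; _:=_; con)

-- The claim has to be contradicted for an actual product measure, so one must be built. Three atoms
-- make it explicit: the average, over all 3ⁿ words, of the seed law carried to one fixed input. The
-- probability of an event is then by definition an average of seed probabilities of its sections,
-- and what is asked of `Success` is measurability of its sections. Excluded middle enters through
-- point masses, which must assign a number to every event, and through conditions on fixed values,
-- which must be measurable as constant events.
--
-- Three letters let the ones, seen first, turn out to lie above or below everything that follows.
-- On both inputs each losing value has k strictly larger ones, so the lenient treatment of ties in
-- `IsTop` does not rescue it. On all other words the algorithm is granted success.
--
-- For e^(-ck) ≤ 9⁻ᵏ the threshold is c = log 9; the value 9 is rational and makes every factor 9k/j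
-- with j ≤ k at least 9, so that (9k)ᵏ/k! is bounded factor by factor.

≤-slack : ∀ {p q} d → 0ℚ ≤ d → q ≡ p + d → p ≤ q
≤-slack {p} {q} d 0≤d q≡p+d = begin
  p      ≡⟨ +-identityʳ p ⟨
  p + 0ℚ ≤⟨ +-monoʳ-≤ p 0≤d ⟩
  p + d  ≡⟨ q≡p+d ⟨
  q      ∎
  where open ≤-Reasoning

slack : ∀ {p q} → p ≤ q → 0ℚ ≤ q - p
slack {p} {q} p≤q = subst (_≤ q - p) (+-inverseʳ p) (+-monoˡ-≤ (- p) p≤q)

p≤∣p∣ : ∀ p → p ≤ ∣ p ∣
p≤∣p∣ p with ∣p∣≡p∨∣p∣≡-p p
... | inj₁ eq = ≤-reflexive (sym eq)
... | inj₂ eq with ≤-total 0ℚ p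
...   | inj₁ 0≤p = ≤-reflexive (sym (0≤p⇒∣p∣≡p 0≤p))
...   | inj₂ p≤0 = ≤-trans p≤0 (0≤∣p∣ p)

0≤p+q : ∀ {p q} → 0ℚ ≤ p → 0ℚ ≤ q → 0ℚ ≤ p + q
0≤p+q = +-mono-≤

∣p-q∣≡∣q-p∣ : ∀ p q → ∣ p - q ∣ ≡ ∣ q - p ∣
∣p-q∣≡∣q-p∣ p q = trans (sym (∣-p∣≡∣p∣ (p - q)))
  (cong ∣_∣ (solve 2 (λ p q → :- (p :- q) := q :- p) refl p q))

-- Power series, given by their coefficients

psum : (ℕ → ℚ) → ℕ → ℚ
psum f zero    = 0ℚ
psum f (suc n) = psum f n + f n

conv : (ℕ → ℚ) → (ℕ → ℚ) → ℕ → ℚ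
conv f g zero    = f 0 * g 0
conv f g (suc m) = f 0 * g (suc m) + conv (f ∘ suc) g m

derivative : (ℕ → ℚ) → ℕ → ℚ
derivative f i = fromℕℚ (suc i) * f (suc i)

conv-cong : ∀ {f f′ g g′} → (∀ i → f i ≡ f′ i) → (∀ i → g i ≡ g′ i) →
  ∀ m → conv f g m ≡ conv f′ g′ m
conv-cong f≡ g≡ zero    = cong₂ _*_ (f≡ 0) (g≡ 0)
conv-cong f≡ g≡ (suc m) =
  cong₂ _+_ (cong₂ _*_ (f≡ 0) (g≡ (suc m))) (conv-cong (f≡ ∘ suc) g≡ m)

conv-+ˡ : ∀ f f′ g m → conv (λ i → f i + f′ i) g m ≡ conv f g m + conv f′ g m
conv-+ˡ f f′ g zero    = *-distribʳ-+ (g 0) (f 0) (f′ 0)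
conv-+ˡ f f′ g (suc m) = trans
  (cong (_+_ ((f 0 + f′ 0) * g (suc m))) (conv-+ˡ (f ∘ suc) (f′ ∘ suc) g m))
  (solve 5 (λ a b c x y → (a :+ b) :* c :+ (x :+ y) := (a :* c :+ x) :+ (b :* c :+ y)) refl
    (f 0) (f′ 0) (g (suc m)) _ _)

conv-*ˡ : ∀ c f g m → conv (λ i → c * f i) g m ≡ c * conv f g m
conv-*ˡ c f g zero    = *-assoc c (f 0) (g 0)
conv-*ˡ c f g (suc m) = trans
  (cong (_+_ (c * f 0 * g (suc m))) (conv-*ˡ c (f ∘ suc) g m))
  (solve 4 (λ c a b x → c :* a :* b :+ c :* x := c :* (a :* b :+ x)) refl c (f 0) (g (suc m)) _)

conv-*ʳ : ∀ c f g m → conv f (λ i → c * g i) m ≡ c * conv f g m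
conv-*ʳ c f g zero    = solve 3 (λ c a b → a :* (c :* b) := c :* (a :* b)) refl c (f 0) (g 0)
conv-*ʳ c f g (suc m) = trans
  (cong (_+_ (f 0 * (c * g (suc m)))) (conv-*ʳ c (f ∘ suc) g m))
  (solve 4 (λ c a b x → a :* (c :* b) :+ c :* x := c :* (a :* b :+ x)) refl c (f 0) (g (suc m)) _)

-- The product rule (fg)′ = f′g + fg′ on coefficients. The induction shifts `f`, and differentiating
-- a shifted series gives weights that are one too small; the spare unit in m + 2 = 1 + (m + 1)
-- supplies the missing copy.
conv-leibniz : ∀ f g m →
  fromℕℚ (suc m) * conv f g (suc m) ≡ conv (derivative f) g m + conv f (derivative g) m
conv-leibniz f g zero =
  solve 4 (λ a b c d → con 1ℚ :* (a :* b :+ c :* d) := con 1ℚ :* c :* d :+ a :* (con 1ℚ :* b))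
    refl (f 0) (g 1) (f 1) (g 0)
conv-leibniz f g (suc m) = begin
  fromℕℚ (2 ℕ.+ m) * (f 0 * g (2 ℕ.+ m) + W)
    ≡⟨ *-distribˡ-+ (fromℕℚ (2 ℕ.+ m)) _ _ ⟩
  fromℕℚ (2 ℕ.+ m) * (f 0 * g (2 ℕ.+ m)) + fromℕℚ (2 ℕ.+ m) * W
    ≡⟨ cong (λ z → fromℕℚ (2 ℕ.+ m) * (f 0 * g (2 ℕ.+ m)) + z * W) (fromℕℚ-suc (suc m)) ⟩
  fromℕℚ (2 ℕ.+ m) * (f 0 * g (2 ℕ.+ m)) + (1ℚ + fromℕℚ (suc m)) * W
    ≡⟨ solve 5 (λ n a b k w → n :* (a :* b) :+ (con 1ℚ :+ k) :* w := a :* (n :* b) :+ w :+ k :* w)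
         refl (fromℕℚ (2 ℕ.+ m)) (f 0) (g (2 ℕ.+ m)) (fromℕℚ (suc m)) W ⟩
  f 0 * derivative g (suc m) + W + fromℕℚ (suc m) * W
    ≡⟨ cong (_+_ (f 0 * derivative g (suc m) + W)) (conv-leibniz (f ∘ suc) g m) ⟩
  f 0 * derivative g (suc m) + (f 1 * g (suc m) + X) + (Y + Z)
    ≡⟨ solve 5 (λ a b x y z → a :+ (b :+ x) :+ (y :+ z) := (con 1ℚ :* b :+ (x :+ y)) :+ (a :+ z))
         refl (f 0 * derivative g (suc m)) (f 1 * g (suc m)) X Y Z ⟩
  1ℚ * (f 1 * g (suc m)) + (X + Y) + (f 0 * derivative g (suc m) + Z)
    ≡⟨ cong (_+ (f 0 * derivative g (suc m) + Z)) (cong₂ _+_ (sym (*-assoc 1ℚ (f 1) (g (suc m)))) shift) ⟩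
  conv (derivative f) g (suc m) + conv f (derivative g) (suc m) ∎
  where
  open ≡-Reasoning
  W = conv (f ∘ suc) g (suc m)
  X = conv (λ i → f (2 ℕ.+ i)) g m
  Y = conv (derivative (f ∘ suc)) g m
  Z = conv (f ∘ suc) (derivative g) m
  shift : X + Y ≡ conv (derivative f ∘ suc) g m
  shift = trans (sym (conv-+ˡ (λ i → f (2 ℕ.+ i)) (derivative (f ∘ suc)) g m)) (conv-cong (λ i → begin
    f (2 ℕ.+ i) + fromℕℚ (suc i) * f (2 ℕ.+ i)
      ≡⟨ solve 2 (λ a k → a :+ k :* a := (con 1ℚ :+ k) :* a) refl (f (2 ℕ.+ i)) (fromℕℚ (suc i)) ⟩
    (1ℚ + fromℕℚ (suc i)) * f (2 ℕ.+ i)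
      ≡⟨ cong (_* f (2 ℕ.+ i)) (fromℕℚ-suc (suc i)) ⟨
    derivative f (suc i) ∎) (λ _ → refl) m)

psum-conv-shift : ∀ f g m → psum (conv f g) (suc m) ≡ f 0 * psum g (suc m) + psum (conv (f ∘ suc) g) m
psum-conv-shift f g zero    =
  solve 2 (λ a b → con 0ℚ :+ a :* b := a :* (con 0ℚ :+ b) :+ con 0ℚ) refl (f 0) (g 0)
psum-conv-shift f g (suc m) = trans
  (cong (_+ conv f g (suc m)) (psum-conv-shift f g m))
  (solve 5 (λ a p b x y → (a :* p :+ x) :+ (a :* b :+ y) := a :* (p :+ b) :+ (x :+ y)) refl
    (f 0) (psum g (suc m)) (g (suc m)) _ _)

-- Both sides add f i * g j over the triangle i + j < m, the left one by antidiagonals and the right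
-- one by rows. Below, `conv f (psum g) m` always stands for this triangular sum.
psum-conv : ∀ f g m → psum (conv f g) m ≡ conv f (psum g) m
psum-conv f g zero    = sym (*-zeroʳ (f 0))
psum-conv f g (suc m) = trans (psum-conv-shift f g m)
  (cong (_+_ (f 0 * psum g (suc m))) (psum-conv (f ∘ suc) g m))

psum-shift : ∀ f n → psum f (suc n) ≡ f 0 + psum (f ∘ suc) n
psum-shift f zero    = trans (+-identityˡ (f 0)) (sym (+-identityʳ (f 0)))
psum-shift f (suc n) = trans (cong (_+ f (suc n)) (psum-shift f n)) (+-assoc (f 0) _ _)

psum-cong : ∀ {f g} → (∀ i → f i ≡ g i) → ∀ n → psum f n ≡ psum g n
psum-cong f≡g zero    = refl
psum-cong f≡g (suc n) = cong₂ _+_ (psum-cong f≡g n) (f≡g n)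

module _ {f : ℕ → ℚ} (0≤f : ∀ i → 0ℚ ≤ f i) where

  psum-nonNeg : ∀ n → 0ℚ ≤ psum f n
  psum-nonNeg zero    = ≤-refl
  psum-nonNeg (suc n) = 0≤p+q (psum-nonNeg n) (0≤f n)

  psum-mono : ∀ d n → psum f n ≤ psum f (d ℕ.+ n)
  psum-mono zero    n = ≤-refl
  psum-mono (suc d) n = ≤-trans (psum-mono d n)
    (≤-slack (f (d ℕ.+ n)) (0≤f (d ℕ.+ n)) refl)

conv-nonNeg : ∀ {f g} → (∀ i → 0ℚ ≤ f i) → (∀ i → 0ℚ ≤ g i) → ∀ m → 0ℚ ≤ conv f g m
conv-nonNeg 0≤f 0≤g zero    = 0≤p*q (0≤f 0) (0≤g 0)
conv-nonNeg 0≤f 0≤g (suc m) =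
  0≤p+q (0≤p*q (0≤f 0) (0≤g (suc m))) (conv-nonNeg (0≤f ∘ suc) 0≤g m)

head≤conv : ∀ {f g} → (∀ i → 0ℚ ≤ f i) → (∀ i → 0ℚ ≤ g i) → ∀ m → f 0 * g m ≤ conv f g m
head≤conv 0≤f 0≤g zero    = ≤-refl
head≤conv 0≤f 0≤g (suc m) = ≤-slack _ (conv-nonNeg (0≤f ∘ suc) 0≤g m) refl

-- The box i ≤ n, j < N lies inside the triangle i + j < n + N, and the remaining terms of the
-- triangle are nonnegative.
square≤triangle : ∀ {f g} → (∀ i → 0ℚ ≤ f i) → (∀ i → 0ℚ ≤ g i) → ∀ n N →
  psum f (suc n) * psum g N ≤ conv f (psum g) (n ℕ.+ N)
square≤triangle {f} {g} 0≤f 0≤g zero N = begin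
  (0ℚ + f 0) * psum g N ≡⟨ cong (_* psum g N) (+-identityˡ (f 0)) ⟩
  f 0 * psum g N        ≤⟨ head≤conv 0≤f (psum-nonNeg 0≤g) N ⟩
  conv f (psum g) N     ∎
  where open ≤-Reasoning
square≤triangle {f} {g} 0≤f 0≤g (suc n) N = begin
  psum f (2 ℕ.+ n) * psum g N
    ≡⟨ cong (_* psum g N) (psum-shift f (suc n)) ⟩
  (f 0 + psum (f ∘ suc) (suc n)) * psum g N
    ≡⟨ *-distribʳ-+ (psum g N) (f 0) _ ⟩
  f 0 * psum g N + psum (f ∘ suc) (suc n) * psum g N
    ≤⟨ +-mono-≤ (*-monoˡ-≤-nonNeg (f 0) {{nonNegative (0≤f 0)}} (psum-mono 0≤g (suc n) N))
                (square≤triangle (0≤f ∘ suc) 0≤g n N) ⟩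
  conv f (psum g) (suc n ℕ.+ N) ∎
  where open ≤-Reasoning

-- A majorant of the coefficients majorises what a rectangle contains beyond a
-- triangle, since every coefficient occurs there with weight 0 or 1.
module _ {g g′ : ℕ → ℚ} (g≤g′ : ∀ i → ∣ g i ∣ ≤ g′ i) where

  psum-majorant : ∀ d n → ∣ psum g (d ℕ.+ n) - psum g n ∣ ≤ psum g′ (d ℕ.+ n) - psum g′ n
  psum-majorant zero    n = ≤-reflexive
    (trans (cong ∣_∣ (+-inverseʳ (psum g n))) (sym (+-inverseʳ (psum g′ n))))
  psum-majorant (suc d) n = begin
    ∣ (s + b) - t ∣      ≡⟨ cong ∣_∣ (solve 3 (λ s b t → (s :+ b) :- t := (s :- t) :+ b) refl s b t) ⟩
    ∣ (s - t) + b ∣      ≤⟨ ∣p+q∣≤∣p∣+∣q∣ (s - t) b ⟩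
    ∣ s - t ∣ + ∣ b ∣    ≤⟨ +-mono-≤ (psum-majorant d n) (g≤g′ (d ℕ.+ n)) ⟩
    (s′ - t′) + b′       ≡⟨ solve 3 (λ s b t → (s :- t) :+ b := (s :+ b) :- t) refl s′ b′ t′ ⟩
    (s′ + b′) - t′       ∎
    where
    open ≤-Reasoning
    s = psum g (d ℕ.+ n)
    t = psum g n
    b = g (d ℕ.+ n)
    s′ = psum g′ (d ℕ.+ n)
    t′ = psum g′ n
    b′ = g′ (d ℕ.+ n)

  private
    head-majorant : ∀ {a a′} → ∣ a ∣ ≤ a′ → ∀ d n →
      ∣ a * psum g (d ℕ.+ n) - a * psum g n ∣ ≤ a′ * psum g′ (d ℕ.+ n) - a′ * psum g′ n
    head-majorant {a} {a′} a≤a′ d n = begin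
      ∣ a * s - a * t ∣     ≡⟨ cong ∣_∣ (solve 3 (λ a s t → a :* s :- a :* t := a :* (s :- t)) refl a s t) ⟩
      ∣ a * (s - t) ∣       ≡⟨ ∣p*q∣≡∣p∣*∣q∣ a (s - t) ⟩
      ∣ a ∣ * ∣ s - t ∣     ≤⟨ Cauchy.*-mono-≤ (0≤∣p∣ (s - t)) (≤-trans (0≤∣p∣ a) a≤a′) a≤a′ (psum-majorant d n) ⟩
      a′ * (s′ - t′)        ≡⟨ solve 3 (λ a s t → a :* (s :- t) := a :* s :- a :* t) refl a′ s′ t′ ⟩
      a′ * s′ - a′ * t′     ∎
      where
      open ≤-Reasoning
      s = psum g (d ℕ.+ n)
      t = psum g n
      s′ = psum g′ (d ℕ.+ n)
      t′ = psum g′ n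

  corner-majorant : ∀ {f f′} → (∀ i → ∣ f i ∣ ≤ f′ i) → ∀ d m →
    ∣ psum f (suc m) * psum g (d ℕ.+ m) - conv f (psum g) m ∣ ≤
    psum f′ (suc m) * psum g′ (d ℕ.+ m) - conv f′ (psum g′) m
  corner-majorant {f} {f′} f≤f′ d zero = begin
    ∣ (0ℚ + f 0) * psum g (d ℕ.+ 0) - f 0 * 0ℚ ∣
      ≡⟨ cong (λ z → ∣ z * psum g (d ℕ.+ 0) - f 0 * 0ℚ ∣) (+-identityˡ (f 0)) ⟩
    ∣ f 0 * psum g (d ℕ.+ 0) - f 0 * 0ℚ ∣
      ≤⟨ head-majorant (f≤f′ 0) d 0 ⟩
    f′ 0 * psum g′ (d ℕ.+ 0) - f′ 0 * 0ℚ
      ≡⟨ cong (λ z → z * psum g′ (d ℕ.+ 0) - f′ 0 * 0ℚ) (+-identityˡ (f′ 0)) ⟨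
    (0ℚ + f′ 0) * psum g′ (d ℕ.+ 0) - f′ 0 * 0ℚ ∎
    where open ≤-Reasoning
  corner-majorant {f} {f′} f≤f′ d (suc m) = begin
    ∣ psum f (2 ℕ.+ m) * s - (f 0 * t + c) ∣
      ≡⟨ cong ∣_∣ (regroup f s t c) ⟩
    ∣ (f 0 * s - f 0 * t) + (psum (f ∘ suc) (suc m) * s - c) ∣
      ≤⟨ ∣p+q∣≤∣p∣+∣q∣ (f 0 * s - f 0 * t) (psum (f ∘ suc) (suc m) * s - c) ⟩
    ∣ f 0 * s - f 0 * t ∣ + ∣ psum (f ∘ suc) (suc m) * s - c ∣
      ≤⟨ +-mono-≤ (head-majorant (f≤f′ 0) d (suc m))
           -- Removing the row i = 0 keeps the width of the rectangle but shortens the triangle by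
           -- one, so the excess width grows from `d` to `suc d`. This is why `d` is arbitrary.
           (subst (λ z → ∣ psum (f ∘ suc) (suc m) * psum g z - c ∣ ≤
                         psum (f′ ∘ suc) (suc m) * psum g′ z - c′)
             (sym (ℕₚ.+-suc d m)) (corner-majorant (f≤f′ ∘ suc) (suc d) m)) ⟩
    (f′ 0 * s′ - f′ 0 * t′) + (psum (f′ ∘ suc) (suc m) * s′ - c′)
      ≡⟨ regroup f′ s′ t′ c′ ⟨
    psum f′ (2 ℕ.+ m) * s′ - (f′ 0 * t′ + c′) ∎
    where
    open ≤-Reasoning
    s = psum g (d ℕ.+ suc m)
    t = psum g (suc m)
    c = conv (f ∘ suc) (psum g) m
    s′ = psum g′ (d ℕ.+ suc m)
    t′ = psum g′ (suc m)
    c′ = conv (f′ ∘ suc) (psum g′) m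
    regroup : ∀ f s t c → psum f (2 ℕ.+ m) * s - (f 0 * t + c) ≡
                          (f 0 * s - f 0 * t) + (psum (f ∘ suc) (suc m) * s - c)
    regroup f s t c = trans (cong (λ z → z * s - (f 0 * t + c)) (psum-shift f (suc m)))
      (solve 5 (λ a p s t c → (a :+ p) :* s :- (a :* t :+ c) := (a :* s :- a :* t) :+ (p :* s :- c))
        refl (f 0) (psum (f ∘ suc) (suc m)) s t c)

-- The exponential series: addition formula and the bound for e^(-x) e^x

expSum≡psum : ∀ q n → expSum q n ≡ psum (expTerm q) n
expSum≡psum q zero    = refl
expSum≡psum q (suc n) = cong (_+ expTerm q n) (expSum≡psum q n)

derivative-expTerm : ∀ q i → derivative (expTerm q) i ≡ q * expTerm q i
derivative-expTerm q i = begin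
  fromℕℚ (suc i) * (expTerm q i * (q * (+ 1 / suc i)))
    ≡⟨ solve 4 (λ k t q r → k :* (t :* (q :* r)) := (k :* r) :* (q :* t)) refl
         (fromℕℚ (suc i)) (expTerm q i) q (+ 1 / suc i) ⟩
  fromℕℚ (suc i) * (+ 1 / suc i) * (q * expTerm q i)
    ≡⟨ cong (_* (q * expTerm q i)) (recip i) ⟩
  1ℚ * (q * expTerm q i)
    ≡⟨ *-identityˡ _ ⟩
  q * expTerm q i ∎
  where open ≡-Reasoning

*-cancel-suc : ∀ m {x y} → fromℕℚ (suc m) * x ≡ fromℕℚ (suc m) * y → x ≡ y
*-cancel-suc m {x} {y} eq = trans (sym (undo x)) (trans (cong ((+ 1 / suc m) *_) eq) (undo y))
  where
  undo : ∀ z → (+ 1 / suc m) * (fromℕℚ (suc m) * z) ≡ z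
  undo z = trans
    (solve 3 (λ r k z → r :* (k :* z) := (k :* r) :* z) refl (+ 1 / suc m) (fromℕℚ (suc m)) z)
    (trans (cong (_* z) (recip m)) (*-identityˡ z))

-- By the product rule both sides solve h′ = (p + q) h, an equation that determines each coefficient
-- from the previous one. This replaces an expansion by the binomial theorem.
conv-expTerm : ∀ p q m → conv (expTerm p) (expTerm q) m ≡ expTerm (p + q) m
conv-expTerm p q zero    = refl
conv-expTerm p q (suc m) = *-cancel-suc m (begin
  fromℕℚ (suc m) * conv (expTerm p) (expTerm q) (suc m)
    ≡⟨ conv-leibniz (expTerm p) (expTerm q) m ⟩
  conv (derivative (expTerm p)) (expTerm q) m + conv (expTerm p) (derivative (expTerm q)) m
    ≡⟨ cong₂ _+_ (conv-cong (derivative-expTerm p) (λ _ → refl) m)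
                 (conv-cong (λ _ → refl) (derivative-expTerm q) m) ⟩
  conv (λ i → p * expTerm p i) (expTerm q) m + conv (expTerm p) (λ i → q * expTerm q i) m
    ≡⟨ cong₂ _+_ (conv-*ˡ p (expTerm p) (expTerm q) m) (conv-*ʳ q (expTerm p) (expTerm q) m) ⟩
  p * conv (expTerm p) (expTerm q) m + q * conv (expTerm p) (expTerm q) m
    ≡⟨ *-distribʳ-+ _ p q ⟨
  (p + q) * conv (expTerm p) (expTerm q) m
    ≡⟨ cong ((p + q) *_) (conv-expTerm p q m) ⟩
  (p + q) * expTerm (p + q) m
    ≡⟨ derivative-expTerm (p + q) m ⟨
  fromℕℚ (suc m) * expTerm (p + q) (suc m) ∎)
  where open ≡-Reasoning

triangle-expSum : ∀ p q n → conv (expTerm p) (psum (expTerm q)) n ≡ expSum (p + q) n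
triangle-expSum p q n = begin
  conv (expTerm p) (psum (expTerm q)) n   ≡⟨ psum-conv (expTerm p) (expTerm q) n ⟨
  psum (conv (expTerm p) (expTerm q)) n   ≡⟨ psum-cong (conv-expTerm p q) n ⟩
  psum (expTerm (p + q)) n                ≡⟨ expSum≡psum (p + q) n ⟨
  expSum (p + q) n                        ∎
  where open ≡-Reasoning

expSum-0 : ∀ n → expSum 0ℚ (suc n) ≡ 1ℚ
expSum-0 zero    = refl
expSum-0 (suc n) = trans
  (cong₂ _+_ (expSum-0 n)
    (trans (cong (expTerm 0ℚ n *_) (*-zeroˡ (+ 1 / suc n))) (*-zeroʳ (expTerm 0ℚ n))))
  (+-identityʳ 1ℚ)

module _ {x : ℚ} (0≤x : 0ℚ ≤ x) where

  expTerm-nonNeg : ∀ i → 0ℚ ≤ expTerm x i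
  expTerm-nonNeg zero    = nonNegative⁻¹ 1ℚ
  expTerm-nonNeg (suc i) = 0≤p*q (expTerm-nonNeg i) (0≤p*q 0≤x (0≤1/ i))

  expTerm-neg : ∀ i → ∣ expTerm (- x) i ∣ ≤ expTerm x i
  expTerm-neg zero    = ≤-refl
  expTerm-neg (suc i) = begin
    ∣ expTerm (- x) (suc i) ∣                        ≡⟨ abs-suc (- x) i ⟩
    ∣ expTerm (- x) i ∣ * (∣ - x ∣ * (+ 1 / suc i))  ≡⟨ cong (λ z → ∣ expTerm (- x) i ∣ * (z * (+ 1 / suc i)))
                                                          (trans (∣-p∣≡∣p∣ x) (0≤p⇒∣p∣≡p 0≤x)) ⟩
    ∣ expTerm (- x) i ∣ * (x * (+ 1 / suc i))        ≤⟨ *-monoʳ-≤-nonNeg _ {{nonNegative (0≤p*q 0≤x (0≤1/ i))}}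
                                                          (expTerm-neg i) ⟩
    expTerm x (suc i)                                ∎
    where open ≤-Reasoning

  -- The product of partial sums runs over the square i, j ≤ n + 1. Its triangle i + j < n + 1
  -- contributes the partial sum of e^0, which is exactly 1. The rest is at most the same corner for
  -- e^x e^x, where the square is enclosed in a larger triangle; the difference of the two triangles
  -- is a stretch of the series for e^(2x).
  expSum-*-neg : ∀ n → expSum (- x) (2 ℕ.+ n) * expSum x (2 ℕ.+ n) ≤
                       1ℚ + (expSum (x + x) (suc n ℕ.+ (2 ℕ.+ n)) - expSum (x + x) (suc n))
  expSum-*-neg n = begin
    expSum (- x) (2 ℕ.+ n) * expSum x (2 ℕ.+ n)
      ≡⟨ cong₂ _*_ (expSum≡psum (- x) (2 ℕ.+ n)) (expSum≡psum x (2 ℕ.+ n)) ⟩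
    a
      ≡⟨ solve 2 (λ a t → a := t :+ (a :- t)) refl a t ⟩
    t + (a - t)
      ≤⟨ +-mono-≤
           (≤-reflexive (trans (triangle-expSum (- x) x (suc n))
             (trans (cong (λ z → expSum z (suc n)) (+-inverseˡ x)) (expSum-0 n))))
           (≤-trans (p≤∣p∣ (a - t))
             (corner-majorant (λ i → ≤-reflexive (0≤p⇒∣p∣≡p (expTerm-nonNeg i))) expTerm-neg 1 (suc n))) ⟩
    1ℚ + (psum (expTerm x) (2 ℕ.+ n) * psum (expTerm x) (2 ℕ.+ n) - t′)
      ≤⟨ +-monoʳ-≤ 1ℚ (+-mono-≤ (square≤triangle expTerm-nonNeg expTerm-nonNeg (suc n) (2 ℕ.+ n)) ≤-refl) ⟩
    1ℚ + (conv (expTerm x) (psum (expTerm x)) (suc n ℕ.+ (2 ℕ.+ n)) - t′)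
      ≡⟨ cong (_+_ 1ℚ) (cong₂ _-_ (triangle-expSum x x (suc n ℕ.+ (2 ℕ.+ n))) (triangle-expSum x x (suc n))) ⟩
    1ℚ + (expSum (x + x) (suc n ℕ.+ (2 ℕ.+ n)) - expSum (x + x) (suc n)) ∎
    where
    open ≤-Reasoning
    a = psum (expTerm (- x)) (2 ℕ.+ n) * psum (expTerm x) (2 ℕ.+ n)
    t = conv (expTerm (- x)) (psum (expTerm x)) (suc n)
    t′ = conv (expTerm x) (psum (expTerm x)) (suc n)

  expSum-neg-≤ : ∀ {r} → 0ℚ ≤ r → ∀ K → (∀ n → K ℕ.≤ n → 1ℚ ≤ expSum x n * r) →
    ∀ ε → 0ℚ < ε → ∃[ N ] ∀ n → N ℕ.≤ n → expSum (- x) n ≤ (1ℚ + ε) * r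
  expSum-neg-≤ {r} 0≤r K large ε 0<ε =
    let N , close = Cauchy.exp-cauchy (λ _ → x + x) (Cauchy.const-cauchy (x + x)) ε 0<ε
    in 2 ℕ.+ (N ℕ.⊔ K) , λ where
      (suc (suc n)) (ℕ.s≤s (ℕ.s≤s N⊔K≤n)) →
        let N≤n = ℕₚ.m⊔n≤o⇒m≤o N K N⊔K≤n
            N≤1+n = ℕₚ.m≤n⇒m≤1+n N≤n
            K≤2+n = ℕₚ.m≤n⇒m≤1+n (ℕₚ.m≤n⇒m≤1+n (ℕₚ.m⊔n≤o⇒n≤o N K N⊔K≤n))
            tail≤ε = ≤-trans (p≤∣p∣ _) (<⇒≤ (close (suc n ℕ.+ (2 ℕ.+ n)) (suc n)
                       (ℕₚ.m≤n⇒m≤o+n (suc n) (ℕₚ.m≤n⇒m≤1+n N≤1+n)) N≤1+n))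
            product≤ = ≤-trans (expSum-*-neg n) (+-monoʳ-≤ 1ℚ tail≤ε)
        in bound (expSum (- x) (2 ℕ.+ n)) (expSum x (2 ℕ.+ n)) (large (2 ℕ.+ n) K≤2+n) product≤
    where
    open ≤-Reasoning
    bound : ∀ a e → 1ℚ ≤ e * r → a * e ≤ 1ℚ + ε → a ≤ (1ℚ + ε) * r
    -- A partial sum of the alternating series may be negative, and multiplying `1≤er` by it would
    -- reverse the inequality; in that case the bound is trivial.
    bound a e 1≤er ae≤ with ≤-total 0ℚ a
    ... | inj₁ 0≤a = begin
      a             ≡⟨ *-identityʳ a ⟨
      a * 1ℚ        ≤⟨ *-monoˡ-≤-nonNeg a {{nonNegative 0≤a}} 1≤er ⟩
      a * (e * r)   ≡⟨ *-assoc a e r ⟨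
      a * e * r     ≤⟨ *-monoʳ-≤-nonNeg r {{nonNegative 0≤r}} ae≤ ⟩
      (1ℚ + ε) * r  ∎
    ... | inj₂ a≤0 = ≤-trans a≤0
      (0≤p*q (0≤p+q (nonNegative⁻¹ 1ℚ) (<⇒≤ 0<ε)) 0≤r)

-- The bound e^(-9k) ≤ 9⁻ᵏ, with 9⁻ᵏ written as `⅓^ (k ℕ.+ k)`

⅓ : ℚ
⅓ = + 1 / 3

infixr 8 ⅓^_
⅓^_ : ℕ → ℚ
⅓^ zero  = 1ℚ
⅓^ suc n = ⅓ * ⅓^ n

0≤⅓^ : ∀ n → 0ℚ ≤ ⅓^ n
0≤⅓^ zero    = nonNegative⁻¹ 1ℚ
0≤⅓^ (suc n) = 0≤p*q {⅓} (nonNegative⁻¹ ⅓) (0≤⅓^ n)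

⅓^≤1 : ∀ n → ⅓^ n ≤ 1ℚ
⅓^≤1 zero    = ≤-refl
⅓^≤1 (suc n) = ≤-trans (*-monoˡ-≤-nonNeg ⅓ (⅓^≤1 n)) (toWitness {a? = ⅓ * 1ℚ ≤? 1ℚ} _)

⅓^-+ : ∀ m n → ⅓^ (m ℕ.+ n) ≡ ⅓^ m * ⅓^ n
⅓^-+ zero    n = sym (*-identityˡ (⅓^ n))
⅓^-+ (suc m) n = trans (cong (⅓ *_) (⅓^-+ m n)) (sym (*-assoc ⅓ (⅓^ m) (⅓^ n)))

9ℚ : ℚ
9ℚ = fromℕℚ 9

module _ (k : ℕ) where

  private
    x : ℚ
    x = 9ℚ * fromℕℚ k

    0≤x : 0ℚ ≤ x
    0≤x = 0≤p*q {9ℚ} (nonNegative⁻¹ 9ℚ) (fromℕℚ-mono {0} {k} ℕ.z≤n)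

  -- Each factor x/j with j ≤ k is at least 9.
  1≤expTerm*⅓^ : ∀ i → i ℕ.≤ k → 1ℚ ≤ expTerm x i * (⅓^ i * ⅓^ i)
  1≤expTerm*⅓^ zero    _   = ≤-refl
  1≤expTerm*⅓^ (suc i) i<k = begin
    1ℚ
      ≤⟨ 1≤expTerm*⅓^ i (ℕₚ.<⇒≤ i<k) ⟩
    T
      ≡⟨ *-identityʳ T ⟨
    T * 1ℚ
      ≡⟨ cong (T *_) (recip i) ⟨
    T * (fromℕℚ (suc i) * (+ 1 / suc i))
      ≤⟨ *-monoˡ-≤-nonNeg T {{nonNegative 0≤T}}
           (*-monoʳ-≤-nonNeg _ {{nonNegative (0≤1/ i)}} (fromℕℚ-mono i<k)) ⟩
    T * (fromℕℚ k * (+ 1 / suc i))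
      ≡⟨ solve 4 (λ t p k r → t :* (p :* p) :* (k :* r) :=
                   t :* ((con 9ℚ :* k) :* r) :* ((con ⅓ :* p) :* (con ⅓ :* p)))
           refl (expTerm x i) (⅓^ i) (fromℕℚ k) (+ 1 / suc i) ⟩
    expTerm x (suc i) * (⅓^ suc i * ⅓^ suc i) ∎
    where
    open ≤-Reasoning
    T = expTerm x i * (⅓^ i * ⅓^ i)
    0≤T = 0≤p*q (expTerm-nonNeg 0≤x i) (0≤p*q (0≤⅓^ i) (0≤⅓^ i))

  1≤expSum*⅓^ : ∀ n → suc k ℕ.≤ n → 1ℚ ≤ expSum x n * ⅓^ (k ℕ.+ k)
  1≤expSum*⅓^ (suc n) (ℕ.s≤s k≤n) = begin
    1ℚ                                    ≤⟨ 1≤expTerm*⅓^ k ℕₚ.≤-refl ⟩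
    expTerm x k * (⅓^ k * ⅓^ k)           ≡⟨ cong (expTerm x k *_) (⅓^-+ k k) ⟨
    expTerm x k * ⅓^ (k ℕ.+ k)            ≤⟨ *-monoʳ-≤-nonNeg _ {{nonNegative (0≤⅓^ (k ℕ.+ k))}} T≤ ⟩
    expSum x (suc n) * ⅓^ (k ℕ.+ k)       ∎
    where
    open ≤-Reasoning
    T≤ : expTerm x k ≤ expSum x (suc n)
    T≤ = begin
      expTerm x k                             ≤⟨ ≤-slack (psum (expTerm x) k) (psum-nonNeg (expTerm-nonNeg 0≤x) k)
                                                   (+-comm (psum (expTerm x) k) (expTerm x k)) ⟩
      psum (expTerm x) (suc k)                ≤⟨ psum-mono (expTerm-nonNeg 0≤x) (n ℕ.∸ k) (suc k) ⟩
      psum (expTerm x) (n ℕ.∸ k ℕ.+ suc k)    ≡⟨ cong (psum (expTerm x)) (trans (ℕₚ.+-suc _ k) (cong suc (ℕₚ.m∸n+n≡m k≤n))) ⟩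
      psum (expTerm x) (suc n)                ≡⟨ expSum≡psum x (suc n) ⟨
      expSum x (suc n)                        ∎

  -- The argument of `exp` is represented by a constant sequence, so the n-th approximation is the
  -- ordinary partial sum `expSum (- x) n` and the bounds in ℚ apply directly.
  exp-≤-⅓^ : exp (-ℝ (fromℚ 9ℚ *ℝ fromℕ k)) ≤ℝ fromℚ (⅓^ (k ℕ.+ k))
  exp-≤-⅓^ ε 0<ε =
    let N , h = expSum-neg-≤ 0≤x (0≤⅓^ (k ℕ.+ k)) (suc k) 1≤expSum*⅓^ ε 0<ε
    in N , λ n N≤n → ≤-trans (h n N≤n) (begin
      (1ℚ + ε) * r   ≡⟨ solve 2 (λ e r → (con 1ℚ :+ e) :* r := r :+ e :* r) refl ε r ⟩
      r + ε * r      ≤⟨ +-monoʳ-≤ r (*-monoˡ-≤-nonNeg ε {{nonNegative (<⇒≤ 0<ε)}} (⅓^≤1 (k ℕ.+ k))) ⟩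
      r + ε * 1ℚ     ≡⟨ cong (_+_ r) (*-identityʳ ε) ⟩
      r + ε          ∎)
    where
    open ≤-Reasoning
    r = ⅓^ (k ℕ.+ k)

<-slack : ∀ {p q} d → 0ℚ < d → q ≡ p + d → p < q
<-slack {p} {q} d 0<d q≡p+d = begin-strict
  p      ≡⟨ +-identityʳ p ⟨
  p + 0ℚ <⟨ +-monoʳ-< p 0<d ⟩
  p + d  ≡⟨ q≡p+d ⟨
  q      ∎
  where open ≤-Reasoning

∣p-q∣<r : ∀ p q {r} → p - q < r → q - p < r → ∣ p - q ∣ < r
∣p-q∣<r p q p-q<r q-p<r with ∣p∣≡p∨∣p∣≡-p (p - q)
... | inj₁ eq = subst (_< _) (sym eq) p-q<r
... | inj₂ eq = subst (_< _) (sym (trans eq (solve 2 (λ p q → :- (p :- q) := q :- p) refl p q))) q-p<r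

∣p-q∣<r⇒p≤q+r : ∀ p q {r} → ∣ p - q ∣ < r → p ≤ q + r
∣p-q∣<r⇒p≤q+r p q {r} h = ≤-slack (r - (p - q)) (slack (≤-trans (p≤∣p∣ (p - q)) (<⇒≤ h)))
  (solve 3 (λ p q r → q :+ r := p :+ (r :- (p :- q))) refl p q r)

-- Order and limits in ℝ

Eventually : (ℕ → Set) → Set
Eventually P = ∃[ N ] ∀ n → N ℕ.≤ n → P n

module _ {P Q : ℕ → Set} where

  ev-map : (∀ n → P n → Q n) → Eventually P → Eventually Q
  ev-map f (N , h) = N , λ n N≤n → f n (h n N≤n)

  ev-× : Eventually P → Eventually Q → Eventually (λ n → P n × Q n)
  ev-× (M , g) (N , h) = M ℕ.⊔ N , λ n le →
    g n (ℕₚ.m⊔n≤o⇒m≤o M N le) , h n (ℕₚ.m⊔n≤o⇒n≤o M N le)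

ev-Fin3 : {P : Fin 3 → ℕ → Set} → (∀ a → Eventually (P a)) → Eventually (λ n → ∀ a → P a n)
ev-Fin3 h = ev-map
  (λ _ (p , q , r) → λ { 0F → p ; 1F → q ; 2F → r })
  (ev-× (h 0F) (ev-× (h 1F) (h 2F)))

≡⇒≈ : ∀ x y → (∀ n → seq x n ≡ seq y n) → x ≈ℝ y
≡⇒≈ x y x≡y ε 0<ε = 0 , λ n _ →
  subst (λ z → ∣ z ∣ < ε) (sym (trans (cong (_- seq y n) (x≡y n)) (+-inverseʳ (seq y n)))) 0<ε

≈-sym : ∀ {x y} → x ≈ℝ y → y ≈ℝ x
≈-sym {x} {y} x≈y ε 0<ε =
  ev-map (λ n → subst (_< ε) (∣p-q∣≡∣q-p∣ (seq x n) (seq y n))) (x≈y ε 0<ε)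

Close : ℚ → ℝ → ℝ → Set
Close ε x y = Eventually (λ n → ∣ seq x n - seq y n ∣ < ε)

close-trans : ∀ {ε x y z} → Close (½ * ε) x y → Close (½ * ε) y z → Close ε x z
close-trans {ε} {x} {y} {z} xy yz = ev-map
  (λ n (p , q) → ≤-<-trans (Cauchy.triangle (seq x n) (seq y n) (seq z n))
    (subst (_ <_) (+-halves ε) (+-mono-< p q))) (ev-× xy yz)

≈-trans : ∀ {x y z} → x ≈ℝ y → y ≈ℝ z → x ≈ℝ z
≈-trans {x} {y} {z} x≈y y≈z ε 0<ε =
  close-trans {ε} {x} {y} {z} (x≈y (½ * ε) (0<½* 0<ε)) (y≈z (½ * ε) (0<½* 0<ε))

≈⇒≤ : ∀ {x y} → x ≈ℝ y → x ≤ℝ y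
≈⇒≤ {x} {y} x≈y ε 0<ε = ev-map (λ n → ∣p-q∣<r⇒p≤q+r (seq x n) (seq y n)) (x≈y ε 0<ε)

≤-pointwise : ∀ x y → (∀ n → seq x n ≤ seq y n) → x ≤ℝ y
≤-pointwise x y x≤y ε 0<ε = 0 , λ n _ →
  ≤-trans (x≤y n) (≤-slack ε (<⇒≤ 0<ε) refl)

≤ℝ-trans : ∀ {x y z} → x ≤ℝ y → y ≤ℝ z → x ≤ℝ z
≤ℝ-trans {x} {y} {z} x≤y y≤z ε 0<ε = ev-map
  (λ n (p , q) → begin
    seq x n                     ≤⟨ p ⟩
    seq y n + ½ * ε             ≤⟨ +-monoˡ-≤ (½ * ε) q ⟩
    seq z n + ½ * ε + ½ * ε     ≡⟨ trans (+-assoc (seq z n) _ _) (cong (_+_ (seq z n)) (+-halves ε)) ⟩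
    seq z n + ε                 ∎)
  (ev-× (x≤y (½ * ε) (0<½* 0<ε)) (y≤z (½ * ε) (0<½* 0<ε)))
  where open ≤-Reasoning

≤ℝ-antisym : ∀ {x y} → x ≤ℝ y → y ≤ℝ x → x ≈ℝ y
≤ℝ-antisym {x} {y} x≤y y≤x ε 0<ε = ev-map
  (λ n (p , q) → ∣p-q∣<r (seq x n) (seq y n) (below (seq x n) (seq y n) p) (below (seq y n) (seq x n) q))
  (ev-× (x≤y (½ * ε) (0<½* 0<ε)) (y≤x (½ * ε) (0<½* 0<ε)))
  where
  below : ∀ p q → p ≤ q + ½ * ε → p - q < ε
  below p q h = <-slack (½ * ε + (q + ½ * ε - p)) (+-mono-<-≤ (0<½* 0<ε) (slack h))
    (solve 3 (λ p q e → e := p :- q :+ (con ½ :* e :+ (q :+ con ½ :* e :- p))) refl p q ε)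

+ℝ-mono-≤ : ∀ {x y u v} → x ≤ℝ y → u ≤ℝ v → x +ℝ u ≤ℝ y +ℝ v
+ℝ-mono-≤ {x} {y} {u} {v} x≤y u≤v ε 0<ε = ev-map
  (λ n (p , q) → subst (seq x n + seq u n ≤_)
    (trans (solve 3 (λ y v e → (y :+ e) :+ (v :+ e) := (y :+ v) :+ (e :+ e)) refl (seq y n) (seq v n) (½ * ε))
      (cong (_+_ (seq y n + seq v n)) (+-halves ε)))
    (+-mono-≤ p q))
  (ev-× (x≤y (½ * ε) (0<½* 0<ε)) (u≤v (½ * ε) (0<½* 0<ε)))

-ℝ-antimono-≤ : ∀ {x y} → x ≤ℝ y → -ℝ y ≤ℝ -ℝ x
-ℝ-antimono-≤ {x} {y} x≤y ε 0<ε = ev-map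
  (λ n p → ≤-slack (seq y n + ε - seq x n) (slack p)
    (solve 3 (λ x y e → :- x :+ e := :- y :+ (y :+ e :- x)) refl (seq x n) (seq y n) ε))
  (x≤y ε 0<ε)

≤ℝ-refl : ∀ x → x ≤ℝ x
≤ℝ-refl x = ≤-pointwise x x λ _ → ≤-refl

<ℝ⇒≱ℝ : ∀ {x y} → x <ℝ y → ¬ y ≤ℝ x
<ℝ⇒≱ℝ {x} {y} (δ , 0<δ , x<y) y≤x =
  let N , h = ev-× x<y (y≤x (½ * δ) (0<½* 0<δ))
      p , q = h N ℕₚ.≤-refl
  in <-irrefl refl (begin-strict
    seq x N + ½ * δ  <⟨ <-slack (½ * δ) (0<½* 0<δ)
                          (solve 2 (λ x d → x :+ d := x :+ con ½ :* d :+ con ½ :* d) refl (seq x N) δ) ⟩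
    seq x N + δ      ≤⟨ p ⟩
    seq y N          ≤⟨ q ⟩
    seq x N + ½ * δ  ∎)
  where open ≤-Reasoning

-- The limit notion `⟶` recast with rational tolerances and distances of approximations, a form that
-- passes easily through sums and averages.
Converges : (ℕ → ℝ) → ℝ → Set
Converges s x = ∀ ε → 0ℚ < ε → Eventually (λ n → Close ε (s n) x)

⟶⇒Converges : ∀ {s x} → s ⟶ x → Converges s x
⟶⇒Converges {s} {x} s⟶x ε 0<ε = ev-map
  (λ n ((δ , 0<δ , l) , (η , 0<η , r)) → ev-map (λ m (p , q) → ∣p-q∣<r (seq (s n) m) (seq x m)
      (<-slack (η + ((seq x m + ε) - (seq (s n) m + η))) (+-mono-<-≤ 0<η (slack q))
        (solve 4 (λ s x e h → e := s :- x :+ (h :+ ((x :+ e) :- (s :+ h)))) refl (seq (s n) m) (seq x m) ε η))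
      (<-slack (δ + (seq (s n) m - (seq x m + (- ε) + δ))) (+-mono-<-≤ 0<δ (slack p))
        (solve 4 (λ s x e h → e := x :- s :+ (h :+ (s :- (x :+ (:- e) :+ h)))) refl (seq (s n) m) (seq x m) ε δ)))
    (ev-× l r))
  (s⟶x (fromℚ ε) (ε , 0<ε , 0 , λ _ _ → ≤-reflexive (+-identityˡ ε)))

Converges⇒⟶ : ∀ {s x} → Converges s x → s ⟶ x
Converges⇒⟶ {s} {x} s→x ε (δ , 0<δ , δ≤ε) = ev-map
  (λ n close →
    -- The strict order on reals demands a positive rational gap: half of `δ` is spent on the
    -- distance to the limit, the other half remains as the gap.
    (½ * δ , 0<½* 0<δ , ev-map
      (λ m (p , d) → ≤-slack ((½ * δ - (seq x m - seq (s n) m)) + (seq ε m - (0ℚ + δ)))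
        (0≤p+q (slack (≤-trans (p≤∣p∣ _)
          (≤-trans (≤-reflexive (∣p-q∣≡∣q-p∣ (seq x m) (seq (s n) m))) (<⇒≤ p)))) (slack d))
        (solve 4 (λ s x e d → s := x :+ (:- e) :+ con ½ :* d :+ ((con ½ :* d :- (x :- s)) :+ (e :- (con 0ℚ :+ d))))
          refl (seq (s n) m) (seq x m) (seq ε m) δ))
      (ev-× close δ≤ε)) ,
    (½ * δ , 0<½* 0<δ , ev-map
      (λ m (p , d) → ≤-slack ((½ * δ - (seq (s n) m - seq x m)) + (seq ε m - (0ℚ + δ)))
        (0≤p+q (slack (≤-trans (p≤∣p∣ _) (<⇒≤ p))) (slack d))
        (solve 4 (λ s x e d → x :+ e := s :+ con ½ :* d :+ ((con ½ :* d :- (s :- x)) :+ (e :- (con 0ℚ :+ d))))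
          refl (seq (s n) m) (seq x m) (seq ε m) δ))
      (ev-× close δ≤ε)))
  (s→x (½ * δ) (0<½* 0<δ))

Converges-resp-≈ : ∀ {s x y} → x ≈ℝ y → Converges s x → Converges s y
Converges-resp-≈ {s} {x} {y} x≈y s→x ε 0<ε =
  ev-map (λ n c → close-trans {ε} {s n} {x} {y} c (x≈y (½ * ε) (0<½* 0<ε))) (s→x (½ * ε) (0<½* 0<ε))

limit-≥ : ∀ {s x b} M → Converges s x → (∀ n → M ℕ.≤ n → b ≤ℝ s n) → b ≤ℝ x
limit-≥ {s} {x} {b} M s→x b≤s ε 0<ε =
  let N , close = s→x (½ * ε) (0<½* 0<ε)
      n = M ℕ.⊔ N
  in ev-map (λ m (p , q) → begin
      seq b m                     ≤⟨ p ⟩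
      seq (s n) m + ½ * ε         ≤⟨ +-monoˡ-≤ (½ * ε) (∣p-q∣<r⇒p≤q+r (seq (s n) m) (seq x m) q) ⟩
      seq x m + ½ * ε + ½ * ε     ≡⟨ trans (+-assoc (seq x m) _ _) (cong (_+_ (seq x m)) (+-halves ε)) ⟩
      seq x m + ε                 ∎)
    (ev-× (b≤s n (ℕₚ.m≤m⊔n M N) (½ * ε) (0<½* 0<ε)) (close n (ℕₚ.m≤n⊔m M N)))
  where open ≤-Reasoning

sumℝ-≥0 : ∀ {n} {f : Vector ℝ n} → (∀ i → 0ℝ ≤ℝ f i) → 0ℝ ≤ℝ sumℝ f
sumℝ-≥0 {zero}  0≤f = ≤ℝ-refl 0ℝ
sumℝ-≥0 {suc n} {f} 0≤f = +ℝ-mono-≤ {0ℝ} {f zero} {0ℝ} {sumℝ (f ∘ suc)} (0≤f zero) (sumℝ-≥0 (0≤f ∘ suc))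

-- Opaque, since equality of reals is checked up to eta, convergence proofs
-- included, and unfolding mean makes these intractable.
opaque

  mean : (Fin 3 → ℝ) → ℝ
  mean f = fromℚ ⅓ *ℝ (f 0F +ℝ (f 1F +ℝ f 2F))

  mean-close : ∀ {ε f g} → (∀ a → Close ε (f a) (g a)) → Close ε (mean f) (mean g)
  mean-close {ε} {f} {g} f~g = ev-map (λ n h →
    let x = λ a → seq (f a) n
        y = λ a → seq (g a) n
        d = λ a → ∣ x a - y a ∣
        open ≤-Reasoning
    in begin-strict
      ∣ ⅓ * (x 0F + (x 1F + x 2F)) - ⅓ * (y 0F + (y 1F + y 2F)) ∣
        ≡⟨ cong ∣_∣ (solve 2 (λ x y → con ⅓ :* x :- con ⅓ :* y := con ⅓ :* (x :- y)) refl
             (x 0F + (x 1F + x 2F)) (y 0F + (y 1F + y 2F))) ⟩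
      ∣ ⅓ * ((x 0F + (x 1F + x 2F)) - (y 0F + (y 1F + y 2F))) ∣
        ≡⟨ ∣p*q∣≡∣p∣*∣q∣ ⅓ ((x 0F + (x 1F + x 2F)) - (y 0F + (y 1F + y 2F))) ⟩
      ⅓ * ∣ (x 0F + (x 1F + x 2F)) - (y 0F + (y 1F + y 2F)) ∣
        ≤⟨ *-monoˡ-≤-nonNeg ⅓ (≤-trans (Cauchy.dist-+ (x 0F) (x 1F + x 2F) (y 0F) (y 1F + y 2F))
             (+-monoʳ-≤ (d 0F) (Cauchy.dist-+ (x 1F) (x 2F) (y 1F) (y 2F)))) ⟩
      ⅓ * (d 0F + (d 1F + d 2F))
        <⟨ *-monoʳ-<-pos ⅓ (+-mono-< (h 0F) (+-mono-< (h 1F) (h 2F))) ⟩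
      ⅓ * (ε + (ε + ε))
        ≡⟨ solve 1 (λ e → con ⅓ :* (e :+ (e :+ e)) := e) refl ε ⟩
      ε ∎) (ev-Fin3 f~g)

  mean-cong : ∀ {f g} → (∀ a → f a ≈ℝ g a) → mean f ≈ℝ mean g
  mean-cong {f} {g} f≈g ε 0<ε = mean-close {ε} {f} {g} (λ a → f≈g a ε 0<ε)

  mean-mono : ∀ {f g} → (∀ a → f a ≤ℝ g a) → mean f ≤ℝ mean g
  mean-mono {f} {g} f≤g ε 0<ε = ev-map (λ n h →
    ≤-trans (*-monoˡ-≤-nonNeg ⅓ (+-mono-≤ (h 0F) (+-mono-≤ (h 1F) (h 2F))))
      (≤-reflexive (solve 4 (λ x y z e →
        con ⅓ :* ((x :+ e) :+ ((y :+ e) :+ (z :+ e))) := con ⅓ :* (x :+ (y :+ z)) :+ e) refl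
        (seq (g 0F) n) (seq (g 1F) n) (seq (g 2F) n) ε)))
    (ev-Fin3 (λ a → f≤g a ε 0<ε))

  sumℝ-mean : ∀ n (f : Fin 3 → Vector ℝ n) j →
    seq (mean (λ a → sumℝ (f a))) j ≡ seq (sumℝ (λ i → mean (λ a → f a i))) j
  sumℝ-mean zero    f j = refl
  sumℝ-mean (suc n) f j = trans
    (solve 6 (λ x y z s t u → con ⅓ :* ((x :+ s) :+ ((y :+ t) :+ (z :+ u))) :=
                              con ⅓ :* (x :+ (y :+ z)) :+ con ⅓ :* (s :+ (t :+ u))) refl
      (seq (f 0F zero) j) (seq (f 1F zero) j) (seq (f 2F zero) j)
      (seq (sumℝ (f 0F ∘ suc)) j) (seq (sumℝ (f 1F ∘ suc)) j) (seq (sumℝ (f 2F ∘ suc)) j))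
    (cong (_+_ (⅓ * (seq (f 0F zero) j + (seq (f 1F zero) j + seq (f 2F zero) j))))
      (sumℝ-mean n (λ a → f a ∘ suc) j))

  mean-converges : ∀ {f : Fin 3 → ℕ → ℝ} {x : Fin 3 → ℝ} →
    (∀ a → Converges (λ n → sumℝ {n} (λ i → f a (toℕ i))) (x a)) →
    Converges (λ n → sumℝ {n} (λ i → mean (λ a → f a (toℕ i)))) (mean x)
  mean-converges {f} {x} f→x ε 0<ε = ev-map
    (λ n h → ev-map
      (λ m → subst (λ z → ∣ z - seq (mean x) m ∣ < ε) (sumℝ-mean n (λ a i → f a (toℕ i)) m))
      (mean-close {ε} {λ a → sumℝ {n} (λ i → f a (toℕ i))} {x} h))
    (ev-Fin3 (λ a → f→x a ε 0<ε))

  mean-const : ∀ x → mean (λ _ → x) ≈ℝ x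
  mean-const x = ≡⇒≈ (mean (λ _ → x)) x
    λ n → solve 1 (λ x → con ⅓ :* (x :+ (x :+ x)) := x) refl (seq x n)

  mean-*ℝ : ∀ c f y → mean (λ a → (c *ℝ f a) *ℝ y) ≈ℝ c *ℝ (mean f *ℝ y)
  mean-*ℝ c f y = ≡⇒≈ (mean (λ a → (c *ℝ f a) *ℝ y)) (c *ℝ (mean f *ℝ y)) λ m →
    solve 5 (λ c x y z r → con ⅓ :* (c :* x :* r :+ (c :* y :* r :+ c :* z :* r)) :=
                           c :* (con ⅓ :* (x :+ (y :+ z)) :* r)) refl
      (seq c m) (seq (f 0F) m) (seq (f 1F) m) (seq (f 2F) m) (seq y m)

  -- Read as failure: a branch of weight 1/3 that misses 1 by y makes the average miss it by y/3,
  -- since no other branch can exceed 1 and compensate.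
  mean-deficit : ∀ a {f y} → (∀ b → f b ≤ℝ 1ℝ) → f a ≤ℝ 1ℝ -ℝ y → mean f ≤ℝ 1ℝ -ℝ fromℚ ⅓ *ℝ y
  mean-deficit a {f} {y} f≤1 fa≤ =
    ≤ℝ-trans {mean f} {mean (g a)} {1ℝ -ℝ fromℚ ⅓ *ℝ y}
      (mean-mono {f} {g a} (f≤g a fa≤))
      (≤-pointwise (mean (g a)) (1ℝ -ℝ fromℚ ⅓ *ℝ y) λ m → ≤-reflexive (mean-g a m))
    where
    g : Fin 3 → Fin 3 → ℝ
    g 0F 0F = 1ℝ -ℝ y
    g 1F 1F = 1ℝ -ℝ y
    g 2F 2F = 1ℝ -ℝ y
    g _  _  = 1ℝ
    f≤g : ∀ a → f a ≤ℝ 1ℝ -ℝ y → ∀ b → f b ≤ℝ g a b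
    f≤g 0F h 0F = h
    f≤g 0F h 1F = f≤1 1F
    f≤g 0F h 2F = f≤1 2F
    f≤g 1F h 0F = f≤1 0F
    f≤g 1F h 1F = h
    f≤g 1F h 2F = f≤1 2F
    f≤g 2F h 0F = f≤1 0F
    f≤g 2F h 1F = f≤1 1F
    f≤g 2F h 2F = h
    mean-g : ∀ a m → seq (mean (g a)) m ≡ 1ℚ - ⅓ * seq y m
    mean-g 0F m = solve 1
      (λ z → con ⅓ :* ((con 1ℚ :- z) :+ (con 1ℚ :+ con 1ℚ)) := con 1ℚ :- con ⅓ :* z) refl (seq y m)
    mean-g 1F m = solve 1
      (λ z → con ⅓ :* (con 1ℚ :+ ((con 1ℚ :- z) :+ con 1ℚ)) := con 1ℚ :- con ⅓ :* z) refl (seq y m)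
    mean-g 2F m = solve 1
      (λ z → con ⅓ :* (con 1ℚ :+ (con 1ℚ :+ (con 1ℚ :- z))) := con 1ℚ :- con ⅓ :* z) refl (seq y m)

  -- The outer branches miss 1 by r (1 - x) and r (1 - y), together by r (2 - (x + y)) ≥ r. Neither
  -- x nor y is bounded by itself, so the two losses have to be added before estimating.
  mean-fork : ∀ {f r x y} → 0ℚ ≤ r → r ≤ 1ℚ → x +ℝ y ≤ℝ 1ℝ →
    f 0F ≤ℝ 1ℝ -ℝ fromℚ r *ℝ (1ℝ -ℝ x) → f 1F ≤ℝ 1ℝ → f 2F ≤ℝ 1ℝ -ℝ fromℚ r *ℝ (1ℝ -ℝ y) →
    mean f ≤ℝ 1ℝ -ℝ fromℚ (⅓ * r)
  mean-fork {f} {r} {x} {y} 0≤r r≤1 x+y≤1 f₀≤ f₁≤ f₂≤ =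
    ≤ℝ-trans {mean f} {mean g} {1ℝ -ℝ fromℚ (⅓ * r)}
      (mean-mono {f} {g} λ { 0F → f₀≤ ; 1F → f₁≤ ; 2F → f₂≤ })
      (λ ε 0<ε → ev-map (λ m h → begin
        seq (mean g) m
          ≡⟨ solve 3 (λ r x y →
               con ⅓ :* ((con 1ℚ :- r :* (con 1ℚ :- x)) :+ (con 1ℚ :+ (con 1ℚ :- r :* (con 1ℚ :- y)))) :=
               (con 1ℚ :- con 2ℚ :* (con ⅓ :* r)) :+ con ⅓ :* r :* (x :+ y)) refl r (seq x m) (seq y m) ⟩
        (1ℚ - 2ℚ * (⅓ * r)) + ⅓ * r * (seq x m + seq y m)
          ≤⟨ +-monoʳ-≤ (1ℚ - 2ℚ * (⅓ * r))
               (*-monoˡ-≤-nonNeg (⅓ * r) {{nonNegative (0≤p*q {⅓} (nonNegative⁻¹ ⅓) 0≤r)}} h) ⟩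
        (1ℚ - 2ℚ * (⅓ * r)) + ⅓ * r * (1ℚ + ε)
          ≡⟨ solve 2 (λ r e → (con 1ℚ :- con 2ℚ :* (con ⅓ :* r)) :+ con ⅓ :* r :* (con 1ℚ :+ e) :=
                              (con 1ℚ :- con ⅓ :* r) :+ r :* (con ⅓ :* e)) refl r ε ⟩
        (1ℚ - ⅓ * r) + r * (⅓ * ε)
          ≤⟨ +-monoʳ-≤ (1ℚ - ⅓ * r) (Cauchy.*-mono-≤
               (0≤p*q {⅓} (nonNegative⁻¹ ⅓) (<⇒≤ 0<ε)) (nonNegative⁻¹ 1ℚ) r≤1
               (*-monoʳ-≤-nonNeg ε {{nonNegative (<⇒≤ 0<ε)}} (⅓^≤1 1))) ⟩
        (1ℚ - ⅓ * r) + 1ℚ * (1ℚ * ε)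
          ≡⟨ cong (_+_ (1ℚ - ⅓ * r)) (trans (*-identityˡ (1ℚ * ε)) (*-identityˡ ε)) ⟩
        (1ℚ - ⅓ * r) + ε ∎) (x+y≤1 ε 0<ε))
    where
    open ≤-Reasoning
    2ℚ : ℚ
    2ℚ = 1ℚ + 1ℚ
    g : Fin 3 → ℝ
    g 0F = 1ℝ -ℝ fromℚ r *ℝ (1ℝ -ℝ x)
    g 1F = 1ℝ
    g 2F = 1ℝ -ℝ fromℚ r *ℝ (1ℝ -ℝ y)

-- Averages of probability measures over words

mixture : ∀ {M} → (Fin 3 → ProbabilityMeasure M) → ProbabilityMeasure M
mixture {M} ν = record
  { prob       = λ E → mean (λ a → prob (ν a) E)
  ; prob-cong  = λ {A} {B} mA A≐B → mean-cong {λ a → prob (ν a) A} {λ a → prob (ν a) B}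
                   (λ a → prob-cong (ν a) mA A≐B)
  ; prob-≥0    = λ {A} mA → ≤ℝ-trans {0ℝ} {mean (λ _ → 0ℝ)} {mean (λ a → prob (ν a) A)}
                   (≈⇒≤ {0ℝ} {mean (λ _ → 0ℝ)} (≈-sym {mean (λ _ → 0ℝ)} {0ℝ} (mean-const 0ℝ)))
                   (mean-mono {λ _ → 0ℝ} {λ a → prob (ν a) A} (λ a → prob-≥0 (ν a) mA))
  ; prob-whole = ≈-trans {mean (λ a → prob (ν a) U)} {mean (λ _ → 1ℝ)} {1ℝ}
                   (mean-cong {λ a → prob (ν a) U} {λ _ → 1ℝ} (λ a → prob-whole (ν a)))
                   (mean-const 1ℝ)
  ; σ-additive = λ {A} mA disjoint →
      Converges⇒⟶ {λ m → sumℝ {m} (λ i → mean (λ a → prob (ν a) (A (toℕ i))))} {mean (λ a → prob (ν a) (⋃ ℕ A))}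
        (mean-converges {λ a i → prob (ν a) (A i)} {λ a → prob (ν a) (⋃ ℕ A)} λ a →
          ⟶⇒Converges {λ m → sumℝ {m} (λ i → prob (ν a) (A (toℕ i)))} {prob (ν a) (⋃ ℕ A)}
            (σ-additive (ν a) mA disjoint))
  }
  where open ProbabilityMeasure using (prob-cong; prob-≥0; prob-whole; σ-additive)

-- The uniform average over all 3ⁿ words, built as nested means so that estimates can follow a
-- chosen word letter by letter.
average : ∀ {M} n → (Vec (Fin 3) n → ProbabilityMeasure M) → ProbabilityMeasure M
average zero    ν = ν []
average (suc n) ν = mixture (λ a → average n (λ w → ν (a ∷ w)))

pushforward : ∀ {M N} (g : Carrier M → Carrier N) →
  (∀ {E} → Measurable N E → Measurable M (E ∘ g)) → ProbabilityMeasure M → ProbabilityMeasure N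
pushforward g g-measurable μ = record
  { prob       = λ E → prob μ (E ∘ g)
  ; prob-cong  = λ mA (A⊆B , B⊆A) → prob-cong (g-measurable mA) (A⊆B , B⊆A)
  ; prob-≥0    = prob-≥0 ∘ g-measurable
  ; prob-whole = prob-whole
  ; σ-additive = λ mA disjoint → σ-additive (g-measurable ∘ mA) (λ i j i≢j x → disjoint i j i≢j (g x))
  }
  where open ProbabilityMeasure μ using (prob-cong; prob-≥0; prob-whole; σ-additive)

-- Multiplying out a product of means over all words, which is the independence of the letters. The
-- constant `c` collects the factors of the letters already fixed.
average-product : ∀ {M E} n (ν : Vec (Fin 3) n → ProbabilityMeasure M) c (g : Fin n → Fin 3 → ℝ) →
  (∀ w → prob (ν w) E ≈ℝ c *ℝ prodℝ (λ i → g i (lookup w i))) →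
  prob (average n ν) E ≈ℝ c *ℝ prodℝ (λ i → mean (g i))
average-product zero ν c g h = h []
average-product {M} {E} (suc n) ν c g h =
  ≈-trans {mean (λ a → prob (average n (λ w → ν (a ∷ w))) E)} {mean (λ a → (c *ℝ g zero a) *ℝ Π)} {target}
    (mean-cong {λ a → prob (average n (λ w → ν (a ∷ w))) E} {λ a → (c *ℝ g zero a) *ℝ Π} λ a →
      average-product {M} {E} n (λ w → ν (a ∷ w)) (c *ℝ g zero a) (g ∘ suc) λ w →
        let Πw = prodℝ (λ i → g (suc i) (lookup w i)) in
        ≈-trans {prob (ν (a ∷ w)) E} {c *ℝ (g zero a *ℝ Πw)} {(c *ℝ g zero a) *ℝ Πw} (h (a ∷ w))
          (≡⇒≈ (c *ℝ (g zero a *ℝ Πw)) ((c *ℝ g zero a) *ℝ Πw)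
            λ m → sym (*-assoc (seq c m) (seq (g zero a) m) (seq Πw m))))
    (mean-*ℝ c (g zero) Π)
  where
  Π = prodℝ (λ i → mean (g (suc i)))
  target = c *ℝ (mean (g zero) *ℝ Π)

module _ {M : MeasurableSpace} {E : Event (Carrier M)} where

  average-≤1 : ∀ n (ν : Vec (Fin 3) n → ProbabilityMeasure M) →
    (∀ w → prob (ν w) E ≤ℝ 1ℝ) → prob (average n ν) E ≤ℝ 1ℝ
  average-≤1 zero    ν h = h []
  average-≤1 (suc n) ν h =
    ≤ℝ-trans {prob (average (suc n) ν) E} {mean (λ _ → 1ℝ)} {1ℝ}
      (mean-mono {λ a → prob (average n (λ w → ν (a ∷ w))) E} {λ _ → 1ℝ} λ a →
        average-≤1 n (λ w → ν (a ∷ w)) (h ∘ (a ∷_)))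
      (≈⇒≤ {mean (λ _ → 1ℝ)} {1ℝ} (mean-const 1ℝ))

  -- The prefix `p` has weight 3⁻ᵏ, so a failure probability of at least y given `p` costs 3⁻ᵏ y
  -- overall: one application of `mean-deficit` per letter.
  average-prefix : ∀ {k} (p : Vec (Fin 3) k) n (ν : Vec (Fin 3) (k ℕ.+ n) → ProbabilityMeasure M) y →
    (∀ w → prob (ν w) E ≤ℝ 1ℝ) →
    prob (average n (λ w → ν (p ++ w))) E ≤ℝ 1ℝ -ℝ y →
    prob (average (k ℕ.+ n) ν) E ≤ℝ 1ℝ -ℝ fromℚ (⅓^ k) *ℝ y
  average-prefix []      n ν y ν≤1 h =
    ≤ℝ-trans {prob (average n ν) E} {1ℝ -ℝ y} {1ℝ -ℝ 1ℝ *ℝ y} h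
      (≤-pointwise (1ℝ -ℝ y) (1ℝ -ℝ 1ℝ *ℝ y) λ m → ≤-reflexive (cong (_-_ 1ℚ) (sym (*-identityˡ (seq y m)))))
  average-prefix {suc k} (a ∷ p) n ν y ν≤1 h =
    ≤ℝ-trans {prob (average (suc k ℕ.+ n) ν) E} {1ℝ -ℝ fromℚ ⅓ *ℝ (fromℚ (⅓^ k) *ℝ y)} {1ℝ -ℝ fromℚ (⅓^ suc k) *ℝ y}
      (mean-deficit a {λ b → prob (average (k ℕ.+ n) (λ w → ν (b ∷ w))) E} {fromℚ (⅓^ k) *ℝ y}
        (λ b → average-≤1 (k ℕ.+ n) (λ w → ν (b ∷ w)) (ν≤1 ∘ (b ∷_)))
        (average-prefix p n (λ w → ν (a ∷ w)) y (ν≤1 ∘ (a ∷_)) h))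
      (≤-pointwise (1ℝ -ℝ fromℚ ⅓ *ℝ (fromℚ (⅓^ k) *ℝ y)) (1ℝ -ℝ fromℚ (⅓^ suc k) *ℝ y)
        λ m → ≤-reflexive (cong (_-_ 1ℚ) (sym (*-assoc ⅓ (⅓^ k) (seq y m)))))

  average-word : ∀ {n} (w : Vec (Fin 3) n) (ν : Vec (Fin 3) n → ProbabilityMeasure M) →
    (∀ w → prob (ν w) E ≤ℝ 1ℝ) →
    prob (average n ν) E ≤ℝ 1ℝ -ℝ fromℚ (⅓^ n) *ℝ (1ℝ -ℝ prob (ν w) E)
  average-word []      ν ν≤1 = ≤-pointwise (prob (ν []) E) (1ℝ -ℝ 1ℝ *ℝ (1ℝ -ℝ prob (ν []) E)) λ m →
    ≤-reflexive (solve 1 (λ x → x := con 1ℚ :- con 1ℚ :* (con 1ℚ :- x)) refl (seq (prob (ν []) E) m))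
  average-word {suc n} (a ∷ w) ν ν≤1 =
    ≤ℝ-trans {prob (average (suc n) ν) E} {1ℝ -ℝ fromℚ ⅓ *ℝ (fromℚ (⅓^ n) *ℝ y)} {1ℝ -ℝ fromℚ (⅓^ suc n) *ℝ y}
      (mean-deficit a {λ b → prob (average n (λ w → ν (b ∷ w))) E} {fromℚ (⅓^ n) *ℝ y}
        (λ b → average-≤1 n (λ w → ν (b ∷ w)) (ν≤1 ∘ (b ∷_)))
        (average-word w (λ w → ν (a ∷ w)) (ν≤1 ∘ (a ∷_))))
      (≤-pointwise (1ℝ -ℝ fromℚ ⅓ *ℝ (fromℚ (⅓^ n) *ℝ y)) (1ℝ -ℝ fromℚ (⅓^ suc n) *ℝ y)
        λ m → ≤-reflexive (cong (_-_ 1ℚ) (sym (*-assoc ⅓ (⅓^ n) (seq y m)))))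
    where y = 1ℝ -ℝ prob (ν (a ∷ w)) E

  -- The two words lie in different branches of the outermost mean, so their failures, which sum to
  -- at least 1, are not counted twice; each has weight 3⁻ˡ inside its branch.
  average-fork : ∀ {l} (u v : Vec (Fin 3) l) (ν : Vec (Fin 3) (suc l) → ProbabilityMeasure M) →
    (∀ w → prob (ν w) E ≤ℝ 1ℝ) →
    prob (ν (0F ∷ u)) E +ℝ prob (ν (2F ∷ v)) E ≤ℝ 1ℝ →
    prob (average (suc l) ν) E ≤ℝ 1ℝ -ℝ fromℚ (⅓^ suc l)
  average-fork {l} u v ν ν≤1 x+y≤1 =
    mean-fork {λ a → prob (average l (λ w → ν (a ∷ w))) E} {⅓^ l} {prob (ν (0F ∷ u)) E} {prob (ν (2F ∷ v)) E}
      (0≤⅓^ l) (⅓^≤1 l) x+y≤1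
      (average-word u (λ w → ν (0F ∷ w)) (ν≤1 ∘ (0F ∷_)))
      (average-≤1 l (λ w → ν (1F ∷ w)) (ν≤1 ∘ (1F ∷_)))
      (average-word v (λ w → ν (2F ∷ w)) (ν≤1 ∘ (2F ∷_)))

-- Words as inputs, and indicators

val : Fin 3 → ℝ
val a = fromℕ (toℕ a)

val-mono : ∀ {a b} → a <ᶠ b → val a <ℝ val b
val-mono {a} {b} a<b = 1ℚ , positive⁻¹ 1ℚ , 0 , λ _ _ → ≤-trans
  (≤-reflexive (trans (+-comm (fromℕℚ (toℕ a)) 1ℚ) (sym (fromℕℚ-suc (toℕ a)))))
  (fromℕℚ-mono a<b)

point : ∀ {n} → Vec (Fin 3) n → Vector ℝ n
point w i = val (lookup w i)

𝟙 : ∀ {P : Set} → Dec P → ℝ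
𝟙 (yes _) = 1ℝ
𝟙 (no  _) = 0ℝ

𝟙-yes : ∀ {P : Set} (d : Dec P) → P → 𝟙 d ≡ 1ℝ
𝟙-yes (yes _) _ = refl
𝟙-yes (no ¬p) p = contradiction p ¬p

𝟙-no : ∀ {P : Set} (d : Dec P) → ¬ P → 𝟙 d ≡ 0ℝ
𝟙-no (yes p) ¬p = contradiction p ¬p
𝟙-no (no _)  _  = refl

𝟙-cong : ∀ {P Q : Set} (d : Dec P) (e : Dec Q) → (P → Q) → (Q → P) → 𝟙 d ≡ 𝟙 e
𝟙-cong (yes p) e f g = sym (𝟙-yes e (f p))
𝟙-cong (no ¬p) e f g = sym (𝟙-no e (¬p ∘ g))

0≤𝟙 : ∀ {P : Set} (d : Dec P) → 0ℝ ≤ℝ 𝟙 d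
0≤𝟙 (yes _) = ≤-pointwise 0ℝ 1ℝ λ _ → nonNegative⁻¹ 1ℚ
0≤𝟙 (no  _) = ≤ℝ-refl 0ℝ

𝟙-sum-none : ∀ {P : ℕ → Set} (d : ∀ i → Dec (P i)) → (∀ i → ¬ P i) →
  ∀ m j → seq (sumℝ {m} (λ i → 𝟙 (d (toℕ i)))) j ≡ 0ℚ
𝟙-sum-none d none zero    j = refl
𝟙-sum-none d none (suc m) j =
  cong₂ _+_ (cong (λ x → seq x j) (𝟙-no (d 0) (none 0))) (𝟙-sum-none (d ∘ suc) (none ∘ suc) m j)

𝟙-sum-one : ∀ {P : ℕ → Set} (d : ∀ i → Dec (P i)) → (∀ i j → i ≢ j → P i → ¬ P j) →
  ∀ i → P i → ∀ m → i ℕ.< m → ∀ j → seq (sumℝ {m} (λ i → 𝟙 (d (toℕ i)))) j ≡ 1ℚ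
𝟙-sum-one d unique zero    p (suc m) _           j =
  cong₂ _+_ (cong (λ x → seq x j) (𝟙-yes (d 0) p))
            (𝟙-sum-none (d ∘ suc) (λ i → unique 0 (suc i) (λ ()) p) m j)
𝟙-sum-one d unique (suc i) p (suc m) (ℕ.s≤s i<m) j =
  cong₂ _+_ (cong (λ x → seq x j) (𝟙-no (d 0) (unique (suc i) 0 (λ ()) p)))
            (𝟙-sum-one (d ∘ suc) (λ i j i≢j → unique (suc i) (suc j) (i≢j ∘ ℕₚ.suc-injective)) i p m i<m j)

𝟙-sum-converges : ∀ {P : ℕ → Set} (d : ∀ i → Dec (P i)) → (∀ i j → i ≢ j → P i → ¬ P j) →
  (e : Dec (∃[ i ] P i)) → Converges (λ m → sumℝ {m} (λ i → 𝟙 (d (toℕ i)))) (𝟙 e)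
𝟙-sum-converges d unique (yes (i , p)) ε 0<ε =
  suc i , λ m i<m → ≡⇒≈ (sumℝ {m} (λ i → 𝟙 (d (toℕ i)))) 1ℝ (𝟙-sum-one d unique i p m i<m) ε 0<ε
𝟙-sum-converges d unique (no ¬∃) ε 0<ε =
  0 , λ m _ → ≡⇒≈ (sumℝ {m} (λ i → 𝟙 (d (toℕ i)))) 0ℝ (𝟙-sum-none d (λ i p → ¬∃ (i , p)) m) ε 0<ε

prodℝ-1 : ∀ {n} {f : Vector ℝ n} → (∀ i → f i ≡ 1ℝ) → ∀ j → seq (prodℝ f) j ≡ 1ℚ
prodℝ-1 {zero}  f≡1 j = refl
prodℝ-1 {suc n} f≡1 j = cong₂ _*_ (cong (λ x → seq x j) (f≡1 zero)) (prodℝ-1 (f≡1 ∘ suc) j)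

prodℝ-0 : ∀ {n} {f : Vector ℝ n} i → f i ≡ 0ℝ → ∀ j → seq (prodℝ f) j ≡ 0ℚ
prodℝ-0 {f = f} zero    f≡0 j = trans (cong (λ x → seq x j * seq (prodℝ (f ∘ suc)) j) f≡0)
  (*-zeroˡ (seq (prodℝ (f ∘ suc)) j))
prodℝ-0 {f = f} (suc i) f≡0 j = trans (cong (seq (f zero) j *_) (prodℝ-0 {f = f ∘ suc} i f≡0 j))
  (*-zeroʳ (seq (f zero) j))

-- Events are arbitrary predicates on functions Fin n → ℝ, so without function
-- extensionality only measurable ones are known to respect pointwise equality.
measurable-ext : ∀ {M n E} → Measurable (M ⊗ℝ^ n) E →
  ∀ {s x y} → (∀ i → x i ≡ y i) → E (s , x) → E (s , y)
measurable-ext (base (rectangle {B = B} _ _)) x≡y (c , b) = c , λ i → subst (B i) (x≡y i) (b i)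
measurable-ext (Generated.resp (A⊆E , E⊆A) mA) x≡y = A⊆E ∘ measurable-ext mA x≡y ∘ E⊆A
measurable-ext Generated.whole x≡y _ = tt
measurable-ext (Generated.complement mA) x≡y ¬a = ¬a ∘ measurable-ext mA (sym ∘ x≡y)
measurable-ext (Generated.union mA) x≡y (i , a) = i , measurable-ext (mA i) x≡y a

-- Measurable sections and the explicit product measure

module _ (em : ExcludedMiddle 0ℓ) where

  module _ {M : MeasurableSpace} where

    private
      module M = MeasurableSpace M

    -- By excluded middle such an event is either everything or empty. It covers the conditions in a
    -- section that concern only the fixed values and not the seed.
    const-measurable : ∀ P → Measurable M (λ _ → P)
    const-measurable P with em {P}
    ... | yes p = M.resp ((λ _ → p) , (λ _ → tt)) M.whole
    ... | no ¬p = M.resp ((λ ¬⊤ → ⊥-elim (¬⊤ tt)) , (λ p → ⊥-elim (¬p p))) (M.complement M.whole)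

    ∪-measurable : ∀ {A B} → Measurable M A → Measurable M B → Measurable M (λ s → A s ⊎ B s)
    ∪-measurable {A} {B} mA mB = M.resp
      ((λ { (zero , a) → inj₁ a ; (suc _ , b) → inj₂ b }) ,
       (λ { (inj₁ a) → 0 , a ; (inj₂ b) → 1 , b }))
      (M.union mE)
      where
      E : ℕ → Event (Carrier M)
      E zero    = A
      E (suc _) = B
      mE : ∀ i → Measurable M (E i)
      mE zero    = mA
      mE (suc _) = mB

    ∩-measurable : ∀ {A B} → Measurable M A → Measurable M B → Measurable M (λ s → A s × B s)
    ∩-measurable {A} {B} mA mB = M.resp
      ((λ {s} h → stable (λ ¬a → h (inj₁ ¬a)) , stable (λ ¬b → h (inj₂ ¬b))) ,
       (λ (a , b) → λ { (inj₁ ¬a) → ¬a a ; (inj₂ ¬b) → ¬b b }))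
      (M.complement (∪-measurable (M.complement mA) (M.complement mB)))
      where
      stable : ∀ {P : Set} → ¬ ¬ P → P
      stable {P} ¬¬p with em {P}
      ... | yes p = p
      ... | no ¬p = ⊥-elim (¬¬p ¬p)

    ∃-measurable : ∀ {n} {A : Fin n → Event (Carrier M)} → (∀ i → Measurable M (A i)) →
      Measurable M (λ s → ∃[ i ] A i s)
    ∃-measurable {zero}  mA = M.resp ((λ ()) , (λ ())) (const-measurable ⊥)
    ∃-measurable {suc n} mA = M.resp
      ((λ { (inj₁ a) → zero , a ; (inj₂ (i , a)) → suc i , a }) ,
       (λ { (zero , a) → inj₁ a ; (suc i , a) → inj₂ (i , a) }))
      (∪-measurable (mA zero) (∃-measurable (mA ∘ suc)))

    -- Additivity is given for infinite sequences, so `A`, `B` and the complement of their union are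
    -- continued by empty events. Those are only known to have probability at least 0 at this point;
    -- hence a bound from partial sums with two or more terms.
    disjoint-≤1 : ∀ (μ : ProbabilityMeasure M) {A B} → Measurable M A → Measurable M B →
      (∀ s → A s → ¬ B s) → prob μ A +ℝ prob μ B ≤ℝ 1ℝ
    disjoint-≤1 μ {A} {B} mA mB A∩B=∅ =
      limit-≥ {λ m → sumℝ {m} (λ i → prob μ (E (toℕ i)))} {1ℝ} {prob μ A +ℝ prob μ B} 2
        (Converges-resp-≈ {λ m → sumℝ {m} (λ i → prob μ (E (toℕ i)))} {prob μ (⋃ ℕ E)} {1ℝ}
          (≈-trans {prob μ (⋃ ℕ E)} {prob μ U} {1ℝ}
            (prob-cong (M.union mE) ((λ _ → tt) , (λ {s} _ → covers s))) prob-whole)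
          (⟶⇒Converges {λ m → sumℝ {m} (λ i → prob μ (E (toℕ i)))} {prob μ (⋃ ℕ E)} (σ-additive mE disjoint)))
        λ { (suc (suc n)) _ →
          let rest = sumℝ {n} (λ i → prob μ (E (2 ℕ.+ toℕ i))) in
          ≤ℝ-trans {prob μ A +ℝ prob μ B} {prob μ A +ℝ (prob μ B +ℝ 0ℝ)} {prob μ A +ℝ (prob μ B +ℝ rest)}
            (≤-pointwise (prob μ A +ℝ prob μ B) (prob μ A +ℝ (prob μ B +ℝ 0ℝ))
              λ m → ≤-reflexive (cong (_+_ (seq (prob μ A) m)) (sym (+-identityʳ (seq (prob μ B) m)))))
            (+ℝ-mono-≤ {prob μ A} {prob μ A} {prob μ B +ℝ 0ℝ} {prob μ B +ℝ rest} (≤ℝ-refl (prob μ A))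
              (+ℝ-mono-≤ {prob μ B} {prob μ B} {0ℝ} {rest} (≤ℝ-refl (prob μ B))
                (sumℝ-≥0 {n} (λ i → prob-≥0 (mE (2 ℕ.+ toℕ i)))))) ;
          (suc zero) (ℕ.s≤s ()) }
      where
      open ProbabilityMeasure μ using (prob-cong; prob-≥0; prob-whole; σ-additive)
      E : ℕ → Event (Carrier M)
      E 0 = A
      E 1 = B
      E 2 = λ s → ¬ (A s ⊎ B s)
      E (suc (suc (suc _))) = λ _ → ⊥
      mE : ∀ i → Measurable M (E i)
      mE 0 = mA
      mE 1 = mB
      mE 2 = M.complement (∪-measurable mA mB)
      mE (suc (suc (suc _))) = const-measurable ⊥
      covers : ∀ s → ⋃ ℕ E s
      covers s with em {A s ⊎ B s}
      ... | yes (inj₁ a) = 0 , a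
      ... | yes (inj₂ b) = 1 , b
      ... | no ¬ab       = 2 , ¬ab
      disjoint< : ∀ i j → i ℕ.< j → ∀ s → E i s → ¬ E j s
      disjoint< 0 1 _ s a b = A∩B=∅ s a b
      disjoint< 0 2 _ s a c = c (inj₁ a)
      disjoint< 1 2 _ s b c = c (inj₂ b)
      disjoint< _ (suc (suc (suc _))) _ s _ ()
      disjoint< (suc _) 1 (ℕ.s≤s ())
      disjoint< (suc (suc _)) 2 (ℕ.s≤s (ℕ.s≤s ()))
      disjoint : ∀ i j → i ≢ j → Empty (E i ∩ E j)
      disjoint i j i≢j s (a , b) with ℕₚ.<-cmp i j
      ... | tri< i<j _ _ = disjoint< i j i<j s a b
      ... | tri≈ _ i≡j _ = i≢j i≡j
      ... | tri> _ _ j<i = disjoint< j i j<i s b a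

    module _ (μ : ProbabilityMeasure M) where

      private
        P = prob μ
        ∅ : Event (Carrier M)
        ∅ = λ _ → ⊥
        0≤P∅ : 0ℝ ≤ℝ P ∅
        0≤P∅ = ProbabilityMeasure.prob-≥0 μ (const-measurable ⊥)

      prob-≤1 : ∀ {A} → Measurable M A → P A ≤ℝ 1ℝ
      prob-≤1 {A} mA = ≤ℝ-trans {P A} {P A +ℝ 0ℝ} {1ℝ}
        (≤-pointwise (P A) (P A +ℝ 0ℝ) λ m → ≤-reflexive (sym (+-identityʳ (seq (P A) m))))
        (≤ℝ-trans {P A +ℝ 0ℝ} {P A +ℝ P ∅} {1ℝ}
          (+ℝ-mono-≤ {P A} {P A} {0ℝ} {P ∅} (≤ℝ-refl (P A)) 0≤P∅)
          (disjoint-≤1 μ mA (const-measurable ⊥) (λ _ _ ())))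

      -- The whole space is disjoint from the empty event, so 1 + P ∅ ≤ 1.
      prob-∅ : P ∅ ≈ℝ 0ℝ
      prob-∅ = ≤ℝ-antisym {P ∅} {0ℝ} P∅≤0 0≤P∅
        where
        1+P∅≤1 : 1ℝ +ℝ P ∅ ≤ℝ 1ℝ
        1+P∅≤1 = ≤ℝ-trans {1ℝ +ℝ P ∅} {P U +ℝ P ∅} {1ℝ}
          (+ℝ-mono-≤ {1ℝ} {P U} {P ∅} {P ∅}
            (≈⇒≤ {1ℝ} {P U} (≈-sym {P U} {1ℝ} (ProbabilityMeasure.prob-whole μ))) (≤ℝ-refl (P ∅)))
          (disjoint-≤1 μ M.whole (const-measurable ⊥) (λ _ _ ()))
        P∅≤0 : P ∅ ≤ℝ 0ℝ
        P∅≤0 ε 0<ε = ev-map (λ m h → ≤-slack (1ℚ + ε - (1ℚ + seq (P ∅) m)) (slack h)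
          (solve 2 (λ p e → con 0ℚ :+ e := p :+ (con 1ℚ :+ e :- (con 1ℚ :+ p))) refl (seq (P ∅) m) ε))
          (1+P∅≤1 ε 0<ε)

  -- Fixing the values commutes with complements and countable unions, and turns a rectangle into
  -- `C` cut down by a constant condition.
  section-measurable : ∀ {M n E} → Measurable (M ⊗ℝ^ n) E → ∀ x → Measurable M (λ s → E (s , x))
  section-measurable {M} (base (rectangle {B = B} mC mB)) x =
    ∩-measurable {M} mC (const-measurable {M} (∀ i → B i (x i)))
  section-measurable {M} (Generated.resp (A⊆E , E⊆A) mA) x =
    MeasurableSpace.resp M (A⊆E , E⊆A) (section-measurable mA x)
  section-measurable {M} Generated.whole x = MeasurableSpace.whole M
  section-measurable {M} (Generated.complement mA) x =
    MeasurableSpace.complement M (section-measurable mA x)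
  section-measurable {M} (Generated.union mA) x =
    MeasurableSpace.union M (λ i → section-measurable (mA i) x)

  dirac : ∀ {M} → Carrier M → ProbabilityMeasure M
  dirac v = record
    { prob       = λ E → 𝟙 (em {E v})
    ; prob-cong  = λ {A} {B} _ (A⊆B , B⊆A) → ≡⇒≈ (𝟙 (em {A v})) (𝟙 (em {B v}))
                     λ m → cong (λ x → seq x m) (𝟙-cong em em A⊆B B⊆A)
    ; prob-≥0    = λ {A} _ → 0≤𝟙 (em {A v})
    ; prob-whole = ≡⇒≈ (𝟙 (em {U v})) 1ℝ λ m → cong (λ x → seq x m) (𝟙-yes em tt)
    ; σ-additive = λ {A} _ disjoint →
        Converges⇒⟶ {λ m → sumℝ {m} (λ i → 𝟙 (em {A (toℕ i) v}))} {𝟙 (em {⋃ ℕ A v})}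
          (𝟙-sum-converges {λ i → A i v} (λ i → em) (λ i j i≢j p q → disjoint i j i≢j v (p , q)) em)
    }

  uniform : ProbabilityMeasure Borel
  uniform = mixture (λ a → dirac (val a))

  -- The joint law of a random seed and the deterministic input `point w`: an event has, by
  -- definition, the probability of its section there.
  at-word : ∀ {M n} → ProbabilityMeasure M → Vec (Fin 3) n → ProbabilityMeasure (M ⊗ℝ^ n)
  at-word {M} {n} μ w =
    pushforward {M} {M ⊗ℝ^ n} (λ s → s , point w) (λ mE → section-measurable mE (point w)) μ

  module _ {M n} (μ : ProbabilityMeasure M) {C} {B : Fin n → Event ℝ} (mC : Measurable M C)
           (x : Vector ℝ n) where

    private
      E : Event (Carrier M)
      E s = Rectangle C B (s , x)

      mE : Measurable M E
      mE = ∩-measurable {M} mC (const-measurable {M} (∀ i → B i (x i)))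

      indicators : Vector ℝ n
      indicators i = 𝟙 (em {B i (x i)})

      open ProbabilityMeasure μ using (prob-cong)

    -- Either some value misses its `B i`, and then the section is empty and the product has a
    -- factor 0; or none does, and then the section is `C` and all factors are 1.
    rectangle-section : prob μ E ≈ℝ prob μ C *ℝ prodℝ indicators
    rectangle-section with em {∃[ i ] ¬ B i (x i)}
    ... | yes (i , ¬b) = ≈-trans {prob μ E} {prob μ (λ _ → ⊥)} {prob μ C *ℝ prodℝ indicators}
      (prob-cong mE ((λ (_ , b) → ¬b (b i)) , λ ()))
      (≈-trans {prob μ (λ _ → ⊥)} {0ℝ} {prob μ C *ℝ prodℝ indicators} (prob-∅ {M} μ)
        (≡⇒≈ 0ℝ (prob μ C *ℝ prodℝ indicators) λ m → sym (trans
          (cong (seq (prob μ C) m *_) (prodℝ-0 {f = indicators} i (𝟙-no (em {B i (x i)}) ¬b) m))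
          (*-zeroʳ (seq (prob μ C) m)))))
    ... | no ¬∃ = ≈-trans {prob μ E} {prob μ C} {prob μ C *ℝ prodℝ indicators}
      (prob-cong mE (proj₁ , (λ c → c , all)))
      (≡⇒≈ (prob μ C) (prob μ C *ℝ prodℝ indicators) λ m → sym (trans
        (cong (seq (prob μ C) m *_) (prodℝ-1 {f = indicators} (λ i → 𝟙-yes (em {B i (x i)}) (all i)) m))
        (*-identityʳ (seq (prob μ C) m))))
      where
      all : ∀ i → B i (x i)
      all i with em {B i (x i)}
      ... | yes b = b
      ... | no ¬b = ⊥-elim (¬∃ (i , ¬b))

  uniform-product : ∀ {M} (μ : ProbabilityMeasure M) n → ProductMeasure μ uniform n
  uniform-product {M} μ n = record
    { measure      = average n (at-word μ)
    ; on-rectangle = λ {C} {B} mC mB →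
        average-product {M ⊗ℝ^ n} {Rectangle C B} n (at-word μ) (prob μ C)
          (λ i a → 𝟙 (em {B i (val a)}))
          (λ w → rectangle-section μ {C} {B} mC (point w))
    }

  -- Measurability at each fixed input is what an average over words calls for. With the values
  -- fixed, `IsTop` is a constant condition, and only the acceptance events depend on the seed.
  success-measurable : ∀ {n} (σ : Strategy n) k x →
    Measurable (Strategy.Seed σ) (λ s → Success σ k (s , x))
  success-measurable σ k x = ∃-measurable {Seed} λ i →
    ∩-measurable {Seed}
      (∩-measurable {Seed} (accepts i)
        (MeasurableSpace.resp Seed ((λ ¬∃ j j<i a → ¬∃ (j , j<i , a)) , (λ h (j , j<i , a) → h j j<i a))
          (MeasurableSpace.complement Seed
            (∃-measurable {Seed} λ j → ∩-measurable {Seed} (const-measurable {Seed} (j <ᶠ i)) (accepts j)))))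
      (const-measurable {Seed} (IsTop k x i))
    where
    open Strategy σ
    accepts : ∀ i → Measurable Seed (λ s → accept i (s , observed x i))
    accepts i = section-measurable (accept-measurable i) (observed x i)

-- The inputs 1ᵏ0ᵏ and 1ᵏ2ᵏ

word : Fin 3 → ∀ k → Vec (Fin 3) (k ℕ.+ k)
word b k = replicate k 1F ++ replicate k b

module _ {A : Set} (a b : A) {m n : ℕ} (i : Fin (m ℕ.+ n)) where

  lookup-blocks-< : toℕ i ℕ.< m → lookup (replicate m a ++ replicate n b) i ≡ a
  lookup-blocks-< i<m =
    trans (lookup-++-< (replicate m a) (replicate n b) i i<m) (lookup-replicate (fromℕ< i<m) a)

  lookup-blocks-≥ : m ℕ.≤ toℕ i → lookup (replicate m a ++ replicate n b) i ≡ b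
  lookup-blocks-≥ i≥m =
    trans (lookup-++-≥ (replicate m a) (replicate n b) i i≥m) (lookup-replicate (reduce≥ i i≥m) b)

∣inside++∣ : ∀ m {n} (T : Subset n) → ∣ replicate m inside ++ T ∣ˢ ≡ m ℕ.+ ∣ T ∣ˢ
∣inside++∣ zero    T = refl
∣inside++∣ (suc m) T = cong suc (∣inside++∣ m T)

∣outside++∣ : ∀ m {n} (T : Subset n) → ∣ replicate m outside ++ T ∣ˢ ≡ ∣ T ∣ˢ
∣outside++∣ zero    T = refl
∣outside++∣ (suc m) T = ∣outside++∣ m T

module _ {k : ℕ} where

  ¬IsTop : ∀ {n} (w : Vec (Fin 3) n) i (T : Subset n) → k ℕ.≤ ∣ T ∣ˢ →
    (∀ {j} → j ∈ˢ T → lookup w i <ᶠ lookup w j) → ¬ IsTop k (point w) i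
  ¬IsTop w i T k≤∣T∣ larger top =
    ℕₚ.<⇒≱ (top T (λ {j} j∈T → val-mono {lookup w i} {lookup w j} (larger j∈T))) k≤∣T∣

  top-0F⇒< : ∀ i → IsTop k (point (word 0F k)) i → toℕ i ℕ.< k
  top-0F⇒< i top = ℕₚ.≰⇒> λ k≤i → ¬IsTop (word 0F k) i T ∣T∣ (λ {j} j∈T →
    subst₂ _<ᶠ_ (sym (lookup-blocks-≥ 1F 0F {k} {k} i k≤i)) (sym (lookup-blocks-< 1F 0F {k} {k} j (j<k j j∈T)))
      (ℕ.s≤s ℕ.z≤n)) top
    where
    -- The block of ones: k values strictly above every zero.
    T : Subset (k ℕ.+ k)
    T = replicate k inside ++ replicate k outside
    ∣T∣ : k ℕ.≤ ∣ T ∣ˢ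
    ∣T∣ = subst (k ℕ.≤_) (sym (∣inside++∣ k (replicate k outside))) (ℕₚ.m≤m+n k _)
    j<k : ∀ j → j ∈ˢ T → toℕ j ℕ.< k
    j<k j j∈T = ℕₚ.≰⇒> λ k≤j →
      contradiction (trans (sym ([]=⇒lookup j∈T)) (lookup-blocks-≥ inside outside {k} {k} j k≤j)) λ ()

  top-2F⇒≥ : ∀ i → IsTop k (point (word 2F k)) i → k ℕ.≤ toℕ i
  top-2F⇒≥ i top = ℕₚ.≮⇒≥ λ i<k → ¬IsTop (word 2F k) i T ∣T∣ (λ {j} j∈T →
    subst₂ _<ᶠ_ (sym (lookup-blocks-< 1F 2F {k} {k} i i<k)) (sym (lookup-blocks-≥ 1F 2F {k} {k} j (k≤j j j∈T)))
      (ℕ.s≤s (ℕ.s≤s ℕ.z≤n))) top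
    where
    T : Subset (k ℕ.+ k)
    T = replicate k outside ++ replicate k inside
    ∣T∣ : k ℕ.≤ ∣ T ∣ˢ
    ∣T∣ = ℕₚ.≤-reflexive (sym (trans (∣outside++∣ k (replicate k inside)) (∣⊤∣≡n k)))
    k≤j : ∀ j → j ∈ˢ T → k ℕ.≤ toℕ j
    k≤j j j∈T = ℕₚ.≮⇒≥ λ j<k →
      contradiction (trans (sym ([]=⇒lookup j∈T)) (lookup-blocks-< outside inside {k} {k} j j<k)) λ ()

  -- Success on 1ᵏ0ᵏ needs a choice in the common prefix 1ᵏ, which is fatal on 1ᵏ2ᵏ.
  success-exclusive : (σ : Strategy (k ℕ.+ k)) → ∀ s →
    Success σ k (s , point (word 0F k)) → ¬ Success σ k (s , point (word 2F k))
  success-exclusive σ s (i , (accepted , _) , top₀) (j , (_ , none-before) , top₂) =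
    none-before i (ℕₚ.<-≤-trans i<k (top-2F⇒≥ j top₂))
      (measurable-ext (Strategy.accept-measurable σ i) same-prefix accepted)
    where
    i<k = top-0F⇒< i top₀
    same-prefix : ∀ l → observed (point (word 0F k)) i l ≡ observed (point (word 2F k)) i l
    same-prefix l = cong val (trans (lookup-blocks-< 1F 0F {k} {k} l′ l′<k)
                                    (sym (lookup-blocks-< 1F 2F {k} {k} l′ l′<k)))
      where
      l′ = inject≤ l (toℕ<n i)
      l′<k : toℕ l′ ℕ.< k
      l′<k = subst (ℕ._< k) (sym (toℕ-inject≤ l (toℕ<n i))) (ℕₚ.<-≤-trans (toℕ<n l) i<k)

-- The bound on the success probability, and the conclusion

module _ (em : ExcludedMiddle 0ℓ) where

  prob-success-≤ : ∀ {k} → 1 ℕ.≤ k → (σ : Strategy (k ℕ.+ k)) →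
    prob (measure (uniform-product em (Strategy.seedLaw σ) (k ℕ.+ k))) (Success σ k) ≤ℝ
    1ℝ -ℝ fromℚ (⅓^ (k ℕ.+ k))
  prob-success-≤ {k@(suc l)} _ σ =
    ≤ℝ-trans {prob (average (k ℕ.+ k) ν) E} {1ℝ -ℝ fromℚ (⅓^ k) *ℝ fromℚ (⅓^ k)} {1ℝ -ℝ fromℚ (⅓^ (k ℕ.+ k))}
      (average-prefix {E = E} (replicate k 1F) k ν (fromℚ (⅓^ k)) ν≤1
        -- The inputs part at the first letter of the second half, which exists because k = l + 1;
        -- `replicate l` is the rest of that half. Prefix and fork contribute a factor 3⁻ᵏ each.
        (average-fork {E = E} (replicate l 0F) (replicate l 2F) (λ w → ν (replicate k 1F ++ w))
          (λ w → ν≤1 (replicate k 1F ++ w))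
          -- Under `ν w` the probability of success is that of the seeds succeeding on w, so two
          -- different inputs are compared as disjoint events in one seed space.
          (disjoint-≤1 em seedLaw
            (success-measurable em σ k (point (word 0F k)))
            (success-measurable em σ k (point (word 2F k)))
            (success-exclusive σ))))
      (≤-pointwise (1ℝ -ℝ fromℚ (⅓^ k) *ℝ fromℚ (⅓^ k)) (1ℝ -ℝ fromℚ (⅓^ (k ℕ.+ k)))
        λ _ → ≤-reflexive (cong (_-_ 1ℚ) (sym (⅓^-+ k k))))
    where
    open Strategy σ
    E = Success σ k
    ν = at-word em {n = k ℕ.+ k} seedLaw
    ν≤1 : ∀ w → prob (ν w) E ≤ℝ 1ℝ
    ν≤1 w = prob-≤1 em seedLaw (success-measurable em σ k (point w))

theorem6 : ExcludedMiddle 0ℓ →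
  Σ[ c ∈ ℝ ] (0ℝ <ℝ c ×
    ((k : ℕ) → 1 ℕ.≤ k →
      ¬ (Σ[ A ∈ Algorithm ]
          ((I : Instance) →
            SelectsTopWithProbabilityMoreThan (1ℝ -ℝ exp (-ℝ (c *ℝ fromℕ k))) k A I))))
theorem6 em = fromℚ 9ℚ , (9ℚ , positive⁻¹ 9ℚ , 0 , λ _ _ → ≤-reflexive (+-identityˡ 9ℚ)) ,
  λ k 1≤k (A , selects) →
    let I = record { size = k ℕ.+ k ; size≥1 = ℕₚ.≤-trans 1≤k (ℕₚ.m≤m+n k k) ; dist = uniform em }
        -- The instance depends on k alone, but the product measure involves the seed law and can be
        -- formed only once `A` is given.
        P = uniform-product em (Strategy.seedLaw (A I)) (k ℕ.+ k)
        e = exp (-ℝ (fromℚ 9ℚ *ℝ fromℕ k))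
        r = fromℚ (⅓^ (k ℕ.+ k))
        p = prob (measure P) (Success (A I) k)
    in <ℝ⇒≱ℝ {1ℝ -ℝ e} {p} (selects I P) (≤ℝ-trans {p} {1ℝ -ℝ r} {1ℝ -ℝ e}
         (prob-success-≤ em 1≤k (A I))
         (+ℝ-mono-≤ {1ℝ} {1ℝ} { -ℝ r} { -ℝ e} (≤ℝ-refl 1ℝ) (-ℝ-antimono-≤ {e} {r} (exp-≤-⅓^ k))))
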